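{- Let $m\ge 1$ and $N\ge m$ be integers. Let $X_N\subseteq\{0,1\}^N$ be the set of words $w=w_0\cdots w_{N-1}$ with $w_i+w_{i+1}+\cdots+w_{i+m}\le 1$ for $i=0,1,\dots,N-m-1$. For $i\in\{0,\dots,N-1\}$ let the toggle $\tau_i:X_N\to X_N$ map $w$ to the word obtained by replacing $w_i$ with $1-w_i$ if the result lies in $X_N$, and to $w$ itself otherwise, and let $\varphi=\tau_{N-1}\circ\tau_{N-2}\circ\cdots\circ\tau_0$. Then for every $S\in X_N$ and every $i\in\{0,1,\dots,N-1\}$, \[ \sum_{t=0}^{q-1}\varphi^t(S)_i=\sum_{t=0}^{q-1}\varphi^t(S)_{N-1-i}, \] where $q$ is the smallest positive integer with $\varphi^q(S)=S$ and $\varphi^t(S)_i$ denotes the $i$-th letter of $\varphi^t(S)$.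
   Context: Each $\tau_i$ is a bijection of $X_N$, so $\varphi$ is a bijection of the finite set $X_N$ and every $S$ has a finite $\varphi$-orbit. For $m=1$, $X_N$ is the set of independent sets of the path graph on $N$ vertices (as indicator words). -}

module Defs where

open import Data.Nat using (ℕ; zero; suc; _+_; _∸_; _≤_; _<_; _<?_; _≤ᵇ_; _<ᵇ_)
open import Data.Bool using (Bool; true; false; not; if_then_else_; _∧_; T)
open import Data.Vec using (Vec; lookup; _[_]%=_)
open import Data.Fin using (Fin; toℕ; fromℕ<)
open import Relation.Nullary using (yes; no)

val : Bool → ℕ
val true  = 1
val false = 0

-- k-th letter of w (indices 0..N-1) as a number; 0 outside the range
-- (never consulted outside the range in the definition of X_N below)
letter : ∀ {N} → Vec Bool N → ℕ → ℕ
letter {N} w k with k <? N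
... | yes k<N = val (lookup w (fromℕ< k<N))
... | no  _   = 0

windowSum : ∀ {N} → Vec Bool N → ℕ → ℕ → ℕ
windowSum w i zero      = 0
windowSum w i (suc len) = letter w i + windowSum w (suc i) len

InX : ℕ → ∀ {N} → Vec Bool N → Set
InX m {N} w = ∀ i → i + m < N → windowSum w i (suc m) ≤ 1

inXb : ℕ → ∀ {N} → Vec Bool N → Bool
inXb m {N} w = go N
  where
  go : ℕ → Bool
  go zero    = true
  go (suc i) = (if (i + m) <ᵇ N then windowSum w i (suc m) ≤ᵇ 1 else true) ∧ go i

toggle : (m : ℕ) → ∀ {N} → Fin N → Vec Bool N → Vec Bool N
toggle m i w with inXb m (w [ i ]%= not)
... | true  = w [ i ]%= not
... | false = w

phiAux : (m : ℕ) → ∀ {N} → ℕ → Vec Bool N → Vec Bool N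
phiAux m {N} zero    w = w
phiAux m {N} (suc k) w with k <? N
... | yes k<N = toggle m (fromℕ< k<N) (phiAux m k w)
... | no  _   = phiAux m k w

phi : (m : ℕ) → ∀ {N} → Vec Bool N → Vec Bool N
phi m {N} w = phiAux m N w

iter : ∀ {A : Set} → (A → A) → ℕ → A → A
iter f zero    x = x
iter f (suc t) x = f (iter f t x)

sumTo : ℕ → (ℕ → ℕ) → ℕ
sumTo zero    g = 0
sumTo (suc q) g = sumTo q g + g q

{-# OPTIONS --safe #-}

-- Put φᵗ(S) in row t of a board. For N > m, a one at (t , i) with i < N − 1 is followed by exactly one of
-- the ones (t , i + m + 1) and (t + 1 , i + 1), and a one in column i > 0 has exactly one predecessor, so the
-- ones form snakes running from column 0 to column N − 1, and column i has as many ones as there are snakes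
-- passing through it. The indicator word of the columns visited by a snake factors as B₁ ⋯ B_K 1^(r+1), where
-- each block is 1^m or 1^(r+1) 0^m with r < m. From the end of B₁ on, the snake is parallel to the next one,
-- whose word is therefore obtained by moving B₁, reversed, to the end. Hence the pattern of block types
-- (a cyclic word of length K) and the run lengths (a cyclic word of length k + 1, where k is the number of
-- blocks of the second type) rotate independently: K (k + 1) consecutive snakes run through all pairs of
-- rotations. Counting the blocks 0^m that cover a given position, averaged over all pairs of rotations,
-- gives a quantity that does not change when the words are read backwards.
--
-- For N = m there is no constraint and φ is complementation.

module Submission where

open import Defs
open import Data.Nat using (ℕ; suc; _≤_; _<_; _∸_)
open import Data.Fin using (Fin; toℕ; opposite)
open import Data.Vec using (Vec; lookup)
open import Data.Bool using (Bool)
open import Relation.Binary.PropositionalEquality using (_≡_; _≢_)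

open import Data.Bool using (true; false; not; if_then_else_; _∧_)
import Data.Bool as Bool
open import Data.Bool.Properties using (T-≡)
open import Data.Empty using (⊥; ⊥-elim)
open import Data.Fin using (fromℕ<)
open import Data.Fin.Properties using (fromℕ<-toℕ; toℕ-fromℕ<; toℕ<n; opposite-prop)
open import Data.List using (List; []; _∷_; _++_; length; replicate)
open import Data.List.Properties using (++-assoc; ++-cancelˡ; ++-identityʳ; length-++; length-replicate)
open import Data.Nat using (zero; _+_; _*_; _%_; _≤ᵇ_; _<ᵇ_; _≤?_; _<?_; _≟_; z≤n; s≤s; >-nonZero)
open import Data.Nat.DivMod using (m<n⇒m%n≡m; [m+n]%n≡m%n)
open import Data.Nat.Properties hiding (_≤?_; _<?_; _≟_)
open import Data.Nat.Tactic.RingSolver using (solve-∀)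
open import Data.Product using (∃; _×_; _,_; proj₁; proj₂)
open import Data.Sum using (_⊎_; inj₁; inj₂)
open import Data.Vec using (_[_]%=_)
open import Data.Vec.Properties using (lookup∘updateAt; lookup∘updateAt′)
open import Function using (_∘_; case_of_; Equivalence)
open import Relation.Binary.PropositionalEquality
open import Relation.Nullary using (¬_; yes; no)
open ≡-Reasoning

-- Finite sums of periodic functions

sumTo-cong< : ∀ n {f g : ℕ → ℕ} → (∀ t → t < n → f t ≡ g t) → sumTo n f ≡ sumTo n g
sumTo-cong< zero    f≗g = refl
sumTo-cong< (suc n) f≗g = cong₂ _+_ (sumTo-cong< n (λ t t<n → f≗g t (m<n⇒m<1+n t<n))) (f≗g n ≤-refl)

sumTo-cong : ∀ n {f g : ℕ → ℕ} → (∀ t → f t ≡ g t) → sumTo n f ≡ sumTo n g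
sumTo-cong n f≗g = sumTo-cong< n (λ t _ → f≗g t)

sumTo-const : ∀ n c → sumTo n (λ _ → c) ≡ n * c
sumTo-const zero    c = refl
sumTo-const (suc n) c = trans (cong (_+ c) (sumTo-const n c)) (+-comm (n * c) c)

sumTo-0 : ∀ n {f : ℕ → ℕ} → (∀ t → t < n → f t ≡ 0) → sumTo n f ≡ 0
sumTo-0 n f≗0 = trans (sumTo-cong< n f≗0) (trans (sumTo-const n 0) (*-zeroʳ n))

sumTo-+ : ∀ n (f g : ℕ → ℕ) → sumTo n (λ t → f t + g t) ≡ sumTo n f + sumTo n g
sumTo-+ zero    f g = refl
sumTo-+ (suc n) f g = trans (cong (_+ (f n + g n)) (sumTo-+ n f g)) (interchange (sumTo n f) (sumTo n g) (f n) (g n))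
  where
  interchange : ∀ a b c d → (a + b) + (c + d) ≡ (a + c) + (b + d)
  interchange = solve-∀

sumTo-*ˡ : ∀ n c (f : ℕ → ℕ) → sumTo n (λ t → c * f t) ≡ c * sumTo n f
sumTo-*ˡ zero    c f = sym (*-zeroʳ c)
sumTo-*ˡ (suc n) c f = trans (cong (_+ c * f n) (sumTo-*ˡ n c f)) (sym (*-distribˡ-+ c (sumTo n f) (f n)))

sumTo-swap : ∀ a b (f : ℕ → ℕ → ℕ) →
  sumTo a (λ x → sumTo b (f x)) ≡ sumTo b (λ y → sumTo a (λ x → f x y))
sumTo-swap zero    b f = sym (sumTo-0 b (λ _ _ → refl))
sumTo-swap (suc a) b f = begin
  sumTo a (λ x → sumTo b (f x)) + sumTo b (f a)           ≡⟨ cong (_+ sumTo b (f a)) (sumTo-swap a b f) ⟩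
  sumTo b (λ y → sumTo a (λ x → f x y)) + sumTo b (f a)   ≡⟨ sumTo-+ b _ (f a) ⟨
  sumTo b (λ y → sumTo a (λ x → f x y) + f a y)           ∎

sumTo-++ : ∀ a b (f : ℕ → ℕ) → sumTo (a + b) f ≡ sumTo a f + sumTo b (λ j → f (a + j))
sumTo-++ a zero    f = trans (cong (λ n → sumTo n f) (+-identityʳ a)) (sym (+-identityʳ (sumTo a f)))
sumTo-++ a (suc b) f = begin
  sumTo (a + suc b) f                                       ≡⟨ cong (λ n → sumTo n f) (+-suc a b) ⟩
  sumTo (a + b) f + f (a + b)                               ≡⟨ cong (_+ f (a + b)) (sumTo-++ a b f) ⟩
  sumTo a f + sumTo b (λ j → f (a + j)) + f (a + b)         ≡⟨ +-assoc (sumTo a f) _ _ ⟩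
  sumTo a f + (sumTo b (λ j → f (a + j)) + f (a + b))       ∎

sumTo-head : ∀ n (f : ℕ → ℕ) → sumTo (suc n) f ≡ f 0 + sumTo n (f ∘ suc)
sumTo-head = sumTo-++ 1

sumTo-reverse : ∀ n (f : ℕ → ℕ) → sumTo n f ≡ sumTo n (λ l → f (n ∸ suc l))
sumTo-reverse zero    f = refl
sumTo-reverse (suc n) f = begin
  sumTo n f + f n                                  ≡⟨ cong (_+ f n) (sumTo-reverse n f) ⟩
  sumTo n (λ l → f (n ∸ suc l)) + f n              ≡⟨ +-comm _ (f n) ⟩
  f n + sumTo n (λ l → f (n ∸ suc l))              ≡⟨ sumTo-head n (λ l → f (n ∸ l)) ⟨
  sumTo (suc n) (λ l → f (n ∸ l))                  ∎

Periodic : {A : Set} → ℕ → (ℕ → A) → Set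
Periodic q f = ∀ t → f (q + t) ≡ f t

Periodic-* : ∀ {A : Set} {q} {f : ℕ → A} → Periodic q f → ∀ a t → f (a * q + t) ≡ f t
Periodic-* per zero    t = refl
Periodic-* {q = q} {f} per (suc a) t =
  trans (cong f (+-assoc q (a * q) t)) (trans (per (a * q + t)) (Periodic-* per a t))

Periodic-shift : ∀ {A : Set} {q} {f : ℕ → A} → Periodic q f → ∀ d → Periodic q (λ t → f (d + t))
Periodic-shift {q = q} {f} per d t = trans (cong f (left-comm d q t)) (per (d + t))
  where
  left-comm : ∀ a b c → a + (b + c) ≡ b + (a + c)
  left-comm = solve-∀

sumTo-shift : ∀ {q} {f : ℕ → ℕ} → Periodic q f → ∀ d → sumTo q (λ t → f (d + t)) ≡ sumTo q f
sumTo-shift per zero = refl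
sumTo-shift {q} {f} per (suc d) = trans (+-cancelˡ-≡ (f (d + 0)) _ _ step) (sumTo-shift per d)
  where
  g : ℕ → ℕ
  g t = f (d + t)
  step : g 0 + sumTo q (λ t → f (suc d + t)) ≡ g 0 + sumTo q g
  step = begin
    g 0 + sumTo q (λ t → f (suc d + t))  ≡⟨ cong (g 0 +_) (sumTo-cong q (λ t → cong f (sym (+-suc d t)))) ⟩
    g 0 + sumTo q (g ∘ suc)              ≡⟨ sumTo-head q g ⟨
    sumTo q g + g q                      ≡⟨ cong (λ x → sumTo q g + g x) (sym (+-identityʳ q)) ⟩
    sumTo q g + g (q + 0)                ≡⟨ cong (sumTo q g +_) (Periodic-shift per d 0) ⟩
    sumTo q g + g 0                      ≡⟨ +-comm (sumTo q g) (g 0) ⟩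
    g 0 + sumTo q g                      ∎

sumTo-* : ∀ {q} {f : ℕ → ℕ} → Periodic q f → ∀ a → sumTo (a * q) f ≡ a * sumTo q f
sumTo-* per zero = refl
sumTo-* {q} {f} per (suc a) = begin
  sumTo (q + a * q) f                               ≡⟨ sumTo-++ q (a * q) f ⟩
  sumTo q f + sumTo (a * q) (λ j → f (q + j))       ≡⟨ cong (sumTo q f +_) (sumTo-cong (a * q) per) ⟩
  sumTo q f + sumTo (a * q) f                       ≡⟨ cong (sumTo q f +_) (sumTo-* per a) ⟩
  sumTo q f + a * sumTo q f                         ∎

-- Words built from blocks

ones zeros : ℕ → List Bool
ones  n = replicate n true
zeros n = replicate n false

at : List Bool → ℕ → ℕ
at []      _       = 0
at (b ∷ _) zero    = val b
at (_ ∷ w) (suc i) = at w i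

below : ℕ → ℕ → ℕ
below _       zero    = 0
below zero    (suc n) = 1
below (suc i) (suc n) = below i n

-- below i n indicates i < n, and seg y l i indicates y ≤ i < y + l.
seg : ℕ → ℕ → ℕ → ℕ
seg zero    l i       = below i l
seg (suc y) l zero    = 0
seg (suc y) l (suc i) = seg y l i

below-seg : ∀ y l i → below i y + seg y l i ≡ below i (y + l)
below-seg zero    l i       = refl
below-seg (suc y) l zero    = refl
below-seg (suc y) l (suc i) = below-seg y l i

below-< : ∀ {i n} → i < n → below i n ≡ 1
below-< {zero}  (s≤s i<n) = refl
below-< {suc i} (s≤s i<n) = below-< i<n

-- With `i` and `j` mirror images in a word of length `u + v`, `j` is among the first `u` positions
-- exactly when `i` is not among the first `v`.
below-reflect : ∀ u v i j → suc (i + j) ≡ u + v → below j u + below i v ≡ 1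
below-reflect zero    v i j       refl = below-< (s≤s (m≤m+n i j))
below-reflect (suc u) v i zero    eq   = cong suc (below-≥ i v (≤-trans (m≤n+m v u) (≤-reflexive (sym (trans (sym (+-identityʳ i)) (suc-injective eq))))))
  where
  below-≥ : ∀ i v → v ≤ i → below i v ≡ 0
  below-≥ i       zero    _         = refl
  below-≥ (suc i) (suc v) (s≤s v≤i) = below-≥ i v v≤i
below-reflect (suc u) v i (suc j) eq   = below-reflect u v i j (trans (sym (+-suc i j)) (suc-injective eq))

-- A position is left of the interval, in it, or right of it, and right of it means among the first
-- `y′` positions of the mirrored word. Adding the two outer indicators to either side therefore
-- gives 1.
seg-reflect : ∀ y l y′ i j → suc (i + j) ≡ y + l + y′ → seg y l j ≡ seg y′ l i
seg-reflect y l y′ i j eq = +-cancelˡ-≡ (below j y + below i y′) _ _ (trans left (sym right))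
  where
  left : below j y + below i y′ + seg y l j ≡ 1
  left = begin
    below j y + below i y′ + seg y l j  ≡⟨ shuffle (below j y) (below i y′) (seg y l j) ⟩
    below j y + seg y l j + below i y′  ≡⟨ cong (_+ below i y′) (below-seg y l j) ⟩
    below j (y + l) + below i y′        ≡⟨ below-reflect (y + l) y′ i j eq ⟩
    1                                   ∎
    where
    shuffle : ∀ a b c → a + b + c ≡ a + c + b
    shuffle = solve-∀
  right : below j y + below i y′ + seg y′ l i ≡ 1
  right = begin
    below j y + below i y′ + seg y′ l i    ≡⟨ +-assoc (below j y) _ _ ⟩
    below j y + (below i y′ + seg y′ l i)  ≡⟨ cong (below j y +_) (below-seg y′ l i) ⟩
    below j y + below i (y′ + l)           ≡⟨ below-reflect y (y′ + l) i j (trans eq (trans (+-assoc y l y′) (cong (y +_) (+-comm l y′)))) ⟩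
    1                                      ∎

at-++-ones : ∀ w c i → at (w ++ ones c) i ≡ at w i + seg (length w) c i
at-++-ones []      zero    i       = refl
at-++-ones []      (suc c) zero    = refl
at-++-ones []      (suc c) (suc i) = at-++-ones [] c i
at-++-ones (b ∷ w) c       zero    = sym (+-identityʳ (val b))
at-++-ones (b ∷ w) c       (suc i) = at-++-ones w c i

at-++-zeros : ∀ w c i → at (w ++ zeros c) i ≡ at w i
at-++-zeros []      zero    i       = refl
at-++-zeros []      (suc c) zero    = refl
at-++-zeros []      (suc c) (suc i) = at-++-zeros [] c i
at-++-zeros (b ∷ w) c       zero    = refl
at-++-zeros (b ∷ w) c       (suc i) = at-++-zeros w c i

ones-+ : ∀ a b → ones (a + b) ≡ ones a ++ ones b
ones-+ zero    b = refl
ones-+ (suc a) b = cong (true ∷_) (ones-+ a b)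

zeros-+ : ∀ a b → zeros (a + b) ≡ zeros a ++ zeros b
zeros-+ zero    b = refl
zeros-+ (suc a) b = cong (false ∷_) (zeros-+ a b)

ones-comm : ∀ a b → ones a ++ ones b ≡ ones b ++ ones a
ones-comm a b = trans (sym (ones-+ a b)) (trans (cong ones (+-comm a b)) (ones-+ b a))

-- `true` marks the block with a gap `0^m`; its run length is stored less one, so that no run is
-- empty. `tailBlock` is the reversal of `headBlock`.
headBlock tailBlock : ℕ → Bool → ℕ → List Bool
headBlock m true  r = ones (suc r) ++ zeros m
headBlock m false r = ones m
tailBlock m true  r = zeros m ++ ones (suc r)
tailBlock m false r = ones m

-- `P` lists the block types and `ρ` the run lengths less one. The run index `x` advances only past
-- a block that uses up a run, so the two sequences have separate indices. `W` counts the runs used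
-- up and `S` adds up run lengths.
module Word (m : ℕ) (P : ℕ → Bool) (ρ : ℕ → ℕ) where

  word : ℕ → ℕ → ℕ → List Bool
  word zero    p x = ones (suc (ρ x))
  word (suc n) p x = headBlock m (P p) (ρ x) ++ word n (suc p) (val (P p) + x)

  W S : ℕ → ℕ → ℕ
  W p l = sumTo l (λ j → val (P (p + j)))
  S x l = sumTo l (λ j → suc (ρ (x + j)))

  W-head : ∀ p l → W p (suc l) ≡ val (P p) + W (suc p) l
  W-head p l = trans (sumTo-head l _)
    (cong₂ _+_ (cong (val ∘ P) (+-identityʳ p)) (sumTo-cong l (λ j → cong (val ∘ P) (+-suc p j))))

  W-++ : ∀ p a b → W p (a + b) ≡ W p a + W (p + a) b
  W-++ p a b = trans (sumTo-++ a b _) (cong (W p a +_) (sumTo-cong b (λ j → cong (val ∘ P) (sym (+-assoc p a j)))))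

  S-++ : ∀ x a b → S x (a + b) ≡ S x a + S (x + a) b
  S-++ x a b = trans (sumTo-++ a b _) (cong (S x a +_) (sumTo-cong b (λ j → cong (suc ∘ ρ) (sym (+-assoc x a j)))))

  -- Grouping each gap with the run after it instead of the run before it turns head blocks into
  -- tail blocks and makes the final run the initial one. A block `1^m` commutes with the run next
  -- to it.
  word-snoc : ∀ n p x → word (suc n) p x ≡ word n p x ++ tailBlock m (P (p + n)) (ρ (x + suc (W p n)))
  word-snoc zero p x rewrite +-identityʳ p | +-comm x 1 with P p
  ... | true  = ++-assoc (ones (suc (ρ x))) (zeros m) _
  ... | false = ones-comm m (suc (ρ x))
  word-snoc (suc n) p x = begin
    headBlock m (P p) (ρ x) ++ word (suc n) (suc p) x′
      ≡⟨ cong (headBlock m (P p) (ρ x) ++_) (word-snoc n (suc p) x′) ⟩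
    headBlock m (P p) (ρ x) ++ word n (suc p) x′ ++ tailBlock m (P (suc p + n)) (ρ (x′ + suc (W (suc p) n)))
      ≡⟨ ++-assoc (headBlock m (P p) (ρ x)) _ _ ⟨
    word (suc n) p x ++ tailBlock m (P (suc p + n)) (ρ (x′ + suc (W (suc p) n)))
      ≡⟨ cong₂ (λ b r → word (suc n) p x ++ tailBlock m b r) (cong P (sym (+-suc p n))) (cong ρ index) ⟩
    word (suc n) p x ++ tailBlock m (P (p + suc n)) (ρ (x + suc (W p (suc n)))) ∎
    where
    x′ : ℕ
    x′ = val (P p) + x
    shuffle : ∀ v x w → v + x + suc w ≡ x + suc (v + w)
    shuffle = solve-∀
    index : x′ + suc (W (suc p) n) ≡ x + suc (W p (suc n))
    index = trans (shuffle (val (P p)) x (W (suc p) n)) (cong (λ w → x + suc w) (sym (W-head p n)))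

  len : ℕ → ℕ → ℕ → ℕ
  len n p x = m * n + S x (suc (W p n))

  len-suc-true : ∀ n p x → P (p + n) ≡ true →
    len (suc n) p x ≡ len n p x + m + suc (ρ (x + suc (W p n)))
  len-suc-true n p x Pn≡true rewrite Pn≡true | +-comm (W p n) 1 =
    shuffle m n (S x (suc (W p n))) (suc (ρ (x + suc (W p n))))
    where
    shuffle : ∀ m n s r → m * suc n + (s + r) ≡ m * n + s + m + r
    shuffle = solve-∀

  len-suc-false : ∀ n p x → P (p + n) ≡ false → len (suc n) p x ≡ len n p x + m
  len-suc-false n p x Pn≡false rewrite Pn≡false | +-identityʳ (W p n) = shuffle m n (S x (suc (W p n)))
    where
    shuffle : ∀ m n s → m * suc n + s ≡ m * n + s + m
    shuffle = solve-∀

  length-word : ∀ n p x → length (word n p x) ≡ len n p x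
  length-word zero p x = trans (length-replicate (suc (ρ x)))
    (trans (cong (suc ∘ ρ) (sym (+-identityʳ x))) (cong (_+ suc (ρ (x + 0))) (sym (*-zeroʳ m))))
  length-word (suc n) p x = trans (cong length (word-snoc n p x))
    (trans (length-++ (word n p x)) (trans (cong (_+ length (tailBlock m (P (p + n)) r)) (length-word n p x)) (by (P (p + n)) refl)))
    where
    r : ℕ
    r = ρ (x + suc (W p n))
    by : ∀ b → P (p + n) ≡ b → len n p x + length (tailBlock m b r) ≡ len (suc n) p x
    by true eq = trans (cong (len n p x +_) (trans (length-++ (zeros m)) (cong₂ _+_ (length-replicate m) (length-replicate (suc r)))))
      (trans (sym (+-assoc (len n p x) m (suc r))) (sym (len-suc-true n p x eq)))
    by false eq = trans (cong (len n p x +_) (length-replicate m)) (sym (len-suc-false n p x eq))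

  -- The number of gaps `0^m` that cover position `i`. By `word-snoc`, the gap of block `p + l`
  -- directly follows the word formed by the `l` blocks before it, so it begins at `len l p x`.
  gaps : ℕ → ℕ → ℕ → ℕ → ℕ
  gaps n p x i = sumTo n (λ l → val (P (p + l)) * seg (len l p x) m i)

  at-gaps : ∀ n p x i → at (word n p x) i + gaps n p x i ≡ below i (len n p x)
  at-gaps zero p x i = begin
    at (ones (suc (ρ x))) i + 0   ≡⟨ +-identityʳ _ ⟩
    at (ones (suc (ρ x))) i       ≡⟨ at-++-ones [] (suc (ρ x)) i ⟩
    below i (suc (ρ x))           ≡⟨ cong (below i) (trans (sym (length-replicate (suc (ρ x)))) (length-word 0 p x)) ⟩
    below i (len 0 p x)           ∎
  at-gaps (suc n) p x i = trans (cong (λ w → at w i + gaps (suc n) p x i) (word-snoc n p x)) (by (P (p + n)) refl)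
    where
    r L : ℕ
    r = ρ (x + suc (W p n))
    L = len n p x
    w : List Bool
    w = word n p x
    |w| : length w ≡ L
    |w| = length-word n p x
    by : ∀ b → P (p + n) ≡ b →
      at (w ++ tailBlock m b r) i + (gaps n p x i + val (P (p + n)) * seg L m i) ≡ below i (len (suc n) p x)
    by true eq = begin
      at (w ++ zeros m ++ ones (suc r)) i + (gaps n p x i + val (P (p + n)) * seg L m i)
        ≡⟨ cong₂ (λ u b → at u i + (gaps n p x i + val b * seg L m i)) (sym (++-assoc w (zeros m) _)) eq ⟩
      at ((w ++ zeros m) ++ ones (suc r)) i + (gaps n p x i + 1 * seg L m i)
        ≡⟨ cong (_+ (gaps n p x i + 1 * seg L m i)) (at-++-ones (w ++ zeros m) (suc r) i) ⟩
      at (w ++ zeros m) i + seg (length (w ++ zeros m)) (suc r) i + (gaps n p x i + 1 * seg L m i)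
        ≡⟨ cong₂ (λ a l → a + seg l (suc r) i + (gaps n p x i + 1 * seg L m i)) (at-++-zeros w m i)
             (trans (length-++ w) (cong₂ _+_ |w| (length-replicate m))) ⟩
      at w i + seg (L + m) (suc r) i + (gaps n p x i + 1 * seg L m i)
        ≡⟨ shuffle (at w i) _ _ (seg L m i) ⟩
      at w i + gaps n p x i + seg L m i + seg (L + m) (suc r) i
        ≡⟨ cong (λ a → a + seg L m i + seg (L + m) (suc r) i) (at-gaps n p x i) ⟩
      below i L + seg L m i + seg (L + m) (suc r) i
        ≡⟨ cong (_+ seg (L + m) (suc r) i) (below-seg L m i) ⟩
      below i (L + m) + seg (L + m) (suc r) i
        ≡⟨ below-seg (L + m) (suc r) i ⟩
      below i (L + m + suc r)
        ≡⟨ cong (below i) (len-suc-true n p x eq) ⟨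
      below i (len (suc n) p x) ∎
      where
      shuffle : ∀ a s g t → a + s + (g + 1 * t) ≡ a + g + t + s
      shuffle = solve-∀
    by false eq = begin
      at (w ++ ones m) i + (gaps n p x i + val (P (p + n)) * seg L m i)
        ≡⟨ cong₂ (λ a b → a + (gaps n p x i + val b * seg L m i)) (at-++-ones w m i) eq ⟩
      at w i + seg (length w) m i + (gaps n p x i + 0)
        ≡⟨ cong (λ l → at w i + seg l m i + (gaps n p x i + 0)) |w| ⟩
      at w i + seg L m i + (gaps n p x i + 0)
        ≡⟨ shuffle (at w i) _ (gaps n p x i) ⟩
      at w i + gaps n p x i + seg L m i
        ≡⟨ cong (_+ seg L m i) (at-gaps n p x i) ⟩
      below i L + seg L m i
        ≡⟨ below-seg L m i ⟩
      below i (L + m)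
        ≡⟨ cong (below i) (len-suc-false n p x eq) ⟨
      below i (len (suc n) p x) ∎
      where
      shuffle : ∀ a s g → a + s + (g + 0) ≡ a + g + s
      shuffle = solve-∀

-- Averages over all rotations

sumTo-blocks : ∀ a b (f : ℕ → ℕ) → sumTo (a * b) f ≡ sumTo a (λ y → sumTo b (λ p → f (y * b + p)))
sumTo-blocks zero    b f = refl
sumTo-blocks (suc a) b f = begin
  sumTo (b + a * b) f                                    ≡⟨ cong (λ n → sumTo n f) (+-comm b (a * b)) ⟩
  sumTo (a * b + b) f                                    ≡⟨ sumTo-++ (a * b) b f ⟩
  sumTo (a * b) f + sumTo b (λ p → f (a * b + p))        ≡⟨ cong (_+ sumTo b (λ p → f (a * b + p))) (sumTo-blocks a b f) ⟩
  sumTo (suc a) (λ y → sumTo b (λ p → f (y * b + p)))    ∎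

-- k ≡ -1 modulo k + 1.
sumTo-stride : ∀ k {f : ℕ → ℕ} → Periodic (suc k) f → ∀ c →
  sumTo (suc k) (λ y → f (y * k + c)) ≡ sumTo (suc k) f
sumTo-stride k {f} per c = begin
  sumTo (suc k) (λ y → f (y * k + c))          ≡⟨ sumTo-reverse (suc k) _ ⟩
  sumTo (suc k) (λ y → f ((k ∸ y) * k + c))    ≡⟨ sumTo-cong< (suc k) pointwise ⟩
  sumTo (suc k) (λ y → f (k * k + c + y))      ≡⟨ sumTo-shift per (k * k + c) ⟩
  sumTo (suc k) f                              ∎
  where
  shuffle : ∀ y z k c → y * suc k + (z * k + c) ≡ (z + y) * k + c + y
  shuffle = solve-∀
  pointwise : ∀ y → y < suc k → f ((k ∸ y) * k + c) ≡ f (k * k + c + y)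
  pointwise y (s≤s y≤k) = begin
    f ((k ∸ y) * k + c)                  ≡⟨ Periodic-* per y _ ⟨
    f (y * suc k + ((k ∸ y) * k + c))    ≡⟨ cong f (shuffle y (k ∸ y) k c) ⟩
    f ((k ∸ y + y) * k + c + y)          ≡⟨ cong (λ z → f (z * k + c + y)) (m∸n+n≡m y≤k) ⟩
    f (k * k + c + y)                    ∎

module Cyclic (m K k : ℕ) (P : ℕ → Bool) (ρ : ℕ → ℕ)
  (periodicP : Periodic K P) (periodicρ : Periodic (suc k) ρ) (count : Word.W m P ρ 0 K ≡ k) where

  open Word m P ρ

  W-periodic : ∀ l → Periodic K (λ p → W p l)
  W-periodic l p = sumTo-cong l (λ j → cong val (trans (cong P (+-assoc K p j)) (periodicP (p + j))))

  S-periodic : ∀ l → Periodic (suc k) (λ x → S x l)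
  S-periodic l x = sumTo-cong l (λ j → cong suc (trans (cong ρ (+-assoc (suc k) x j)) (periodicρ (x + j))))

  W-full : ∀ p → W p K ≡ k
  W-full p = trans (sumTo-shift (λ t → cong val (periodicP t)) p) count

  width : ℕ
  width = m * K + S 0 (suc k)

  S-full : ∀ x → S x (suc k) ≡ S 0 (suc k)
  S-full x = sumTo-shift (λ t → cong suc (periodicρ t)) x

  len-full : ∀ p x → len K p x ≡ width
  len-full p x = cong (m * K +_) (trans (cong (λ n → S x (suc n)) (W-full p)) (S-full x))

  gaps-periodic-p : ∀ n x i → Periodic K (λ p → gaps n p x i)
  gaps-periodic-p n x i p = sumTo-cong n (λ l → cong₂ (λ b w → val b * seg (m * l + S x (suc w)) m i)
    (trans (cong P (+-assoc K p l)) (periodicP (p + l))) (W-periodic l p))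

  gaps-periodic-x : ∀ n p i → Periodic (suc k) (λ x → gaps n p x i)
  gaps-periodic-x n p i x = sumTo-cong n (λ l → cong (λ s → val (P (p + l)) * seg (m * l + s) m i)
    (S-periodic (suc (W p l)) x))

  W-multiple : ∀ y p → W 0 (y * K + p) ≡ y * k + W 0 p
  W-multiple y p = trans (W-++ 0 (y * K) p) (cong₂ _+_
    (trans (sumTo-* {f = val ∘ P} (λ t → cong val (periodicP t)) y) (cong (y *_) count))
    (trans (cong (λ z → W z p) (sym (+-identityʳ (y * K)))) (Periodic-* (W-periodic p) y 0)))

  -- For `s = y * K + p` the block rotation is `p` and the run rotation is `y * k + W 0 p`, which
  -- for fixed `p` takes every residue modulo `k + 1` once.
  sumTo-orbit : (f : ℕ → ℕ → ℕ) → (∀ x → Periodic K (λ p → f p x)) → (∀ p → Periodic (suc k) (f p)) →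
    sumTo (suc k * K) (λ s → f s (W 0 s)) ≡ sumTo K (λ p → sumTo (suc k) (f p))
  sumTo-orbit f per₁ per₂ = begin
    sumTo (suc k * K) (λ s → f s (W 0 s))
      ≡⟨ sumTo-blocks (suc k) K _ ⟩
    sumTo (suc k) (λ y → sumTo K (λ p → f (y * K + p) (W 0 (y * K + p))))
      ≡⟨ sumTo-cong (suc k) (λ y → sumTo-cong K (λ p →
           trans (Periodic-* (per₁ (W 0 (y * K + p))) y p) (cong (f p) (W-multiple y p)))) ⟩
    sumTo (suc k) (λ y → sumTo K (λ p → f p (y * k + W 0 p)))
      ≡⟨ sumTo-swap (suc k) K _ ⟩
    sumTo K (λ p → sumTo (suc k) (λ y → f p (y * k + W 0 p)))
      ≡⟨ sumTo-cong K (λ p → sumTo-stride k (per₂ p) (W 0 p)) ⟩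
    sumTo K (λ p → sumTo (suc k) (f p)) ∎

  -- Up to the antiderivative H of g, both summands are differences of H (W p (l + 1)) with H at a
  -- window of length l.
  telescope : ∀ l (g : ℕ → ℕ) →
    sumTo K (λ p → val (P (p + l)) * g (W p l)) ≡ sumTo K (λ p → val (P p) * g (W (suc p) l))
  telescope l g = +-cancelʳ-≡ (sumTo K (λ p → H (W p l))) _ _ (begin
    sumTo K (λ p → val (P (p + l)) * g (W p l)) + sumTo K (λ p → H (W p l))
      ≡⟨ sumTo-+ K _ _ ⟨
    sumTo K (λ p → val (P (p + l)) * g (W p l) + H (W p l))
      ≡⟨ sumTo-cong K (λ p → trans (difference (P (p + l)) (W p l)) (cong H (+-comm (val (P (p + l))) (W p l)))) ⟩
    sumTo K (λ p → H (W p (suc l)))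
      ≡⟨ sumTo-cong K (λ p → trans (cong H (W-head p l)) (sym (difference (P p) (W (suc p) l)))) ⟩
    sumTo K (λ p → val (P p) * g (W (suc p) l) + H (W (suc p) l))
      ≡⟨ sumTo-+ K _ _ ⟩
    sumTo K (λ p → val (P p) * g (W (suc p) l)) + sumTo K (λ p → H (W (suc p) l))
      ≡⟨ cong (sumTo K (λ p → val (P p) * g (W (suc p) l)) +_) (sumTo-shift (λ p → cong H (W-periodic l p)) 1) ⟩
    sumTo K (λ p → val (P p) * g (W (suc p) l)) + sumTo K (λ p → H (W p l)) ∎)
    where
    H : ℕ → ℕ
    H n = sumTo n g
    difference : ∀ b w → val b * g w + H w ≡ H (val b + w)
    difference true  w = trans (cong (_+ H w) (+-identityʳ (g w))) (+-comm (g w) (H w))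
    difference false w = refl

  -- Read backwards, the gap of block `p + l` is preceded by the other `l′` blocks, contributing `m`
  -- letters each, and by those of the `k + 1` runs that are not among the `W p l + 1` runs before
  -- the gap.
  seg-len-reflect : ∀ i j → suc (i + j) ≡ width → ∀ p x l l′ → K ≡ suc l + l′ → P (p + l) ≡ true →
    seg (len l p x) m j ≡ seg (m * l′ + S (suc (W p l) + x) (suc (W (suc (p + l)) l′))) m i
  seg-len-reflect i j eq p x l l′ K≡ Pl≡true = seg-reflect (len l p x) m y′ i j (trans eq (begin
    m * K + S 0 (suc k)                         ≡⟨ cong (m * K +_) (S-full x) ⟨
    m * K + S x (suc k)                         ≡⟨ cong₂ (λ a b → m * a + S x b) K≡ 1+k≡ ⟩
    m * (suc l + l′) + S x (suc w + suc w′)     ≡⟨ cong (m * (suc l + l′) +_) (S-++ x (suc w) (suc w′)) ⟩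
    m * (suc l + l′) + (S x (suc w) + S (x + suc w) (suc w′))
                                                ≡⟨ shuffle m l l′ (S x (suc w)) (S (x + suc w) (suc w′)) ⟩
    len l p x + m + (m * l′ + S (x + suc w) (suc w′))
                                                ≡⟨ cong (λ z → len l p x + m + (m * l′ + S z (suc w′))) (+-comm x (suc w)) ⟩
    len l p x + m + y′ ∎))
    where
    w w′ y′ : ℕ
    w  = W p l
    w′ = W (suc (p + l)) l′
    y′ = m * l′ + S (suc w + x) (suc w′)
    shuffle : ∀ m l l′ a b → m * (suc l + l′) + (a + b) ≡ m * l + a + m + (m * l′ + b)
    shuffle = solve-∀
    1+k≡ : suc k ≡ suc w + suc w′
    1+k≡ = cong suc (begin
      k                                        ≡⟨ W-full p ⟨
      W p K                                    ≡⟨ cong (W p) K≡ ⟩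
      W p (suc l + l′)                         ≡⟨ W-++ p (suc l) l′ ⟩
      W p l + val (P (p + l)) + W (p + suc l) l′
        ≡⟨ cong₂ (λ b z → w + val b + W z l′) Pl≡true (+-suc p l) ⟩
      w + 1 + w′                               ≡⟨ +-assoc w 1 w′ ⟩
      w + suc w′                               ∎)

  module _ (i j : ℕ) (eq : suc (i + j) ≡ width) where

    -- How often a gap preceded by `l` blocks and `n + 1` runs covers `i`, over all rotations of the
    -- run lengths. This sum is independent of the index at which the runs begin.
    G : ℕ → ℕ → ℕ
    G l n = sumTo (suc k) (λ x → seg (m * l + S x (suc n)) m i)

    sum-gaps : ∀ i′ → sumTo K (λ p → sumTo (suc k) (λ x → gaps K p x i′)) ≡
      sumTo K (λ l → sumTo K (λ p → val (P (p + l)) * sumTo (suc k) (λ x → seg (len l p x) m i′)))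
    sum-gaps i′ = trans (sumTo-cong K (λ p → trans (sumTo-swap (suc k) K _)
      (sumTo-cong K (λ l → sumTo-*ˡ (suc k) (val (P (p + l))) _)))) (sumTo-swap K K _)

    -- Reflection turns `l` blocks before the gap into `K ∸ suc l`. The runs after the gap begin at
    -- index `suc (W p l) + x`, an offset that the sum over `x` absorbs.
    reflected : ∀ l → l < K → ∀ p →
      val (P (p + l)) * sumTo (suc k) (λ x → seg (len l p x) m j) ≡
      val (P (l + p)) * G (K ∸ suc l) (W (suc (l + p)) (K ∸ suc l))
    reflected l l<K p with P (p + l) in Pl≡
    ... | false rewrite +-comm l p | Pl≡ = refl
    ... | true  rewrite +-comm l p | Pl≡ = cong (1 *_) (begin
      sumTo (suc k) (λ x → seg (len l p x) m j)
        ≡⟨ sumTo-cong (suc k) (λ x → seg-len-reflect i j eq p x l l′ (sym (m+[n∸m]≡n l<K)) Pl≡) ⟩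
      sumTo (suc k) (λ x → seg (m * l′ + S (suc (W p l) + x) (suc w′)) m i)
        ≡⟨ sumTo-shift (λ x → cong (λ s → seg (m * l′ + s) m i) (S-periodic (suc w′) x)) (suc (W p l)) ⟩
      G l′ w′ ∎)
      where
      l′ w′ : ℕ
      l′ = K ∸ suc l
      w′ = W (suc (p + l)) l′

    -- By `telescope`, over all rotations the windows of `l` blocks in front of a gap and those
    -- behind a gap have the same distribution of `W`. Replacing `l` by `K ∸ suc l` then gives the
    -- form in which `reflected` leaves the sum for `j`.
    gaps-symmetric : sumTo K (λ p → sumTo (suc k) (λ x → gaps K p x i)) ≡
                     sumTo K (λ p → sumTo (suc k) (λ x → gaps K p x j))
    gaps-symmetric = begin
      sumTo K (λ p → sumTo (suc k) (λ x → gaps K p x i))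
        ≡⟨ sum-gaps i ⟩
      sumTo K (λ l → sumTo K (λ p → val (P (p + l)) * G l (W p l)))
        ≡⟨ sumTo-cong K (λ l → telescope l (G l)) ⟩
      sumTo K (λ l → sumTo K (λ p → val (P p) * G l (W (suc p) l)))
        ≡⟨ sumTo-reverse K _ ⟩
      sumTo K (λ l → sumTo K (λ p → val (P p) * G (K ∸ suc l) (W (suc p) (K ∸ suc l))))
        -- Renumbering the rotations puts the marked gap at block `l + p`, as in `reflected`.
        ≡⟨ sumTo-cong K (λ l → sym (sumTo-shift (λ p → cong₂ (λ b w → val b * G (K ∸ suc l) w)
             (periodicP p) (W-suc-periodic (K ∸ suc l) p)) l)) ⟩
      sumTo K (λ l → sumTo K (λ p → val (P (l + p)) * G (K ∸ suc l) (W (suc (l + p)) (K ∸ suc l))))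
        ≡⟨ sumTo-cong< K (λ l l<K → sumTo-cong K (λ p → sym (reflected l l<K p))) ⟩
      sumTo K (λ l → sumTo K (λ p → val (P (p + l)) * sumTo (suc k) (λ x → seg (len l p x) m j)))
        ≡⟨ sum-gaps j ⟨
      sumTo K (λ p → sumTo (suc k) (λ x → gaps K p x j)) ∎
      where
      W-suc-periodic : ∀ l → Periodic K (λ p → W (suc p) l)
      W-suc-periodic l = Periodic-shift (W-periodic l) 1

    -- Each position inside the word holds a one or lies in one gap, so it suffices to compare the
    -- gaps, and `sumTo-orbit` turns the sum over snakes into a sum over all pairs of rotations.
    word-symmetric : sumTo (suc k * K) (λ s → at (word K s (W 0 s)) i) ≡
                     sumTo (suc k * K) (λ s → at (word K s (W 0 s)) j)
    word-symmetric = +-cancelʳ-≡ (sumTo T (λ s → gaps K s (W 0 s) i)) _ _ (begin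
      sumTo T (λ s → at (word K s (W 0 s)) i) + sumTo T (λ s → gaps K s (W 0 s) i)
        ≡⟨ complement i (≤-trans (s≤s (m≤m+n i j)) (≤-reflexive eq)) ⟩
      T * 1
        ≡⟨ complement j (≤-trans (s≤s (m≤n+m j i)) (≤-reflexive eq)) ⟨
      sumTo T (λ s → at (word K s (W 0 s)) j) + sumTo T (λ s → gaps K s (W 0 s) j)
        ≡⟨ cong (sumTo T (λ s → at (word K s (W 0 s)) j) +_) (trans (orbit j) (trans (sym gaps-symmetric) (sym (orbit i)))) ⟩
      sumTo T (λ s → at (word K s (W 0 s)) j) + sumTo T (λ s → gaps K s (W 0 s) i) ∎)
      where
      T : ℕ
      T = suc k * K
      complement : ∀ i′ → i′ < width →
        sumTo T (λ s → at (word K s (W 0 s)) i′) + sumTo T (λ s → gaps K s (W 0 s) i′) ≡ T * 1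
      complement i′ i′<width = trans (sym (sumTo-+ T _ _)) (trans (sumTo-cong T (λ s →
        trans (at-gaps K s (W 0 s) i′) (trans (cong (below i′) (len-full s (W 0 s))) (below-< i′<width)))) (sumTo-const T 1))
      orbit : ∀ i′ → sumTo T (λ s → gaps K s (W 0 s) i′) ≡ sumTo K (λ p → sumTo (suc k) (λ x → gaps K p x i′))
      orbit i′ = sumTo-orbit (λ p x → gaps K p x i′) (λ x → gaps-periodic-p K x i′) (λ p → gaps-periodic-x K p i′)

-- Snakes on a board

-- When column `i` of row `t + 1` is decided, the columns before `i` hold new letters and those from
-- `i` on old ones. `vert` and `fill` describe this mixed word; they include the old letter in
-- column `i` itself, because a one there is toggled off.
record IsBoard (m N′ : ℕ) (a : ℕ → ℕ → Bool) : Set where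
  field
    range : ∀ {t i} → a t i ≡ true → i ≤ N′
    indep : ∀ {t i j} → a t i ≡ true → a t j ≡ true → i < j → j ≤ i + m → ⊥
    vert  : ∀ {t i j} → a (suc t) i ≡ true → a t j ≡ true → i ≤ j → j ≤ i + m → ⊥
    fill  : ∀ {t i} → i ≤ N′ → (∀ j → i ≤ j → j ≤ i + m → ¬ a t j ≡ true) →
            (∀ j → j < i → i ≤ j + m → ¬ a (suc t) j ≡ true) → a (suc t) i ≡ true

module Board (μ N′ : ℕ) (a : ℕ → ℕ → Bool) (isBoard : IsBoard (suc μ) N′ a) where

  open IsBoard isBoard

  m : ℕ
  m = suc μ

  One : ℕ → ℕ → Set
  One t i = a t i ≡ true

  -- Old ones in columns `i + 1` to `i + 1 + m` are excluded by the one at `i` and the missing jump;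
  -- a new one close enough on the left would itself contradict `(t , i)`.
  climb : ∀ {t i} → One t i → i < N′ → ¬ One t (i + suc m) → One (suc t) (suc i)
  climb {t} {i} o i<N′ no-jump = fill i<N′ old new
    where
    old : ∀ j → suc i ≤ j → j ≤ suc i + m → ¬ One t j
    old j i<j j≤ o′ with j ≤? i + m
    ... | yes j≤i+m = indep o o′ i<j j≤i+m
    ... | no  j≰i+m = no-jump (subst (One t) (≤-antisym (≤-trans j≤ (≤-reflexive (sym (+-suc i m))))
                        (≤-trans (≤-reflexive (+-suc i m)) (≰⇒> j≰i+m))) o′)
    new : ∀ j → j < suc i → suc i ≤ j + m → ¬ One (suc t) j
    new j (s≤s j≤i) i<j+m o′ = vert o′ o j≤i (<⇒≤ i<j+m)

  not-both : ∀ {t i} → One t (i + suc m) → ¬ One (suc t) (suc i)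
  not-both {t} {i} jumped climbed = vert climbed jumped
    (≤-trans (m≤m+n (suc i) m) (≤-reflexive (sym (+-suc i m)))) (≤-reflexive (+-suc i m))

  -- Path t i w: the snake starting at the one in row t and column i runs up to column N′, and
  -- w marks the columns i , … , N′ in which it has a one.
  data Path : ℕ → ℕ → List Bool → Set where
    end  : ∀ {t i} → i ≡ N′ → One t i → Path t i (true ∷ [])
    up   : ∀ {t i w} → One t i → Path (suc t) (suc i) w → Path t i (true ∷ w)
    jump : ∀ {t i v w} → One t i → v ≡ zeros m ++ w → Path t (i + suc m) w → Path t i (true ∷ v)

  origin : ∀ {t i w} → Path t i w → One t i
  origin (end _ o)    = o
  origin (up o _)     = o
  origin (jump o _ _) = o

  follow′ : ∀ n {t i} → One t i → N′ ≤ n + i → ∃ (Path t i)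
  follow′ zero    o N′≤i = _ , end (≤-antisym (range o) N′≤i) o
  follow′ (suc n) {t} {i} o N′≤ with i ≟ N′
  ... | yes i≡N′ = _ , end i≡N′ o
  ... | no  i≢N′ with a t (i + suc m) in eq
  ...   | true  = _ , jump o refl (proj₂ (follow′ n eq (≤-trans N′≤
                    (≤-trans (≤-reflexive (sym (+-suc n i))) (+-monoʳ-≤ n (≤-trans (s≤s (m≤m+n i m)) (≤-reflexive (sym (+-suc i m)))))))))
  ...   | false = _ , up o (proj₂ (follow′ n (climb o (≤∧≢⇒< (range o) i≢N′) (λ o′ → true≢false (trans (sym o′) eq)))
                    (≤-trans N′≤ (≤-reflexive (sym (+-suc n i))))))
    where
    true≢false : ¬ true ≡ false
    true≢false ()

  follow : ∀ {t i} → One t i → ∃ (Path t i)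
  follow o = follow′ N′ o (m≤m+n N′ _)

  below-top : ∀ {t i} → One t (suc i) → ¬ i ≡ N′
  below-top o refl = 1+n≰n (range o)

  jump-below-top : ∀ {t i} → One t (i + suc m) → ¬ i ≡ N′
  jump-below-top {i = i} o refl = 1+n≰n (≤-trans (≤-trans (s≤s (m≤m+n i m)) (≤-reflexive (sym (+-suc i m)))) (range o))

  Path-unique : ∀ {t i v w} → Path t i v → Path t i w → v ≡ w
  Path-unique (end _ _) (end _ _) = refl
  Path-unique (end eq _) (up _ q) = ⊥-elim (below-top (origin q) eq)
  Path-unique (end eq _) (jump _ _ q) = ⊥-elim (jump-below-top (origin q) eq)
  Path-unique (up _ p) (end eq _) = ⊥-elim (below-top (origin p) eq)
  Path-unique (up _ p) (up _ q) = cong (true ∷_) (Path-unique p q)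
  Path-unique (up _ p) (jump _ _ q) = ⊥-elim (not-both (origin q) (origin p))
  Path-unique (jump _ _ p) (end eq _) = ⊥-elim (jump-below-top (origin p) eq)
  Path-unique (jump _ _ p) (up _ q) = ⊥-elim (not-both (origin p) (origin q))
  Path-unique (jump _ refl p) (jump _ refl q) = cong (λ w → true ∷ zeros m ++ w) (Path-unique p q)

  Path-jump : ∀ {t i Y} → Path t i (true ∷ zeros m ++ Y) → Path t (i + suc m) Y
  Path-jump {t} {i} {Y} (jump {w = w} _ eq p) = subst (Path t (i + suc m)) (sym (++-cancelˡ (zeros m) Y w eq)) p

  Path-ones : ∀ c {t i Y} → Path t i (ones c ++ true ∷ Y) →
    Path (c + t) (c + i) (true ∷ Y) × (∀ y → y ≤ c → One (y + t) (y + i))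
  Path-ones zero    p = p , λ { .zero z≤n → origin p }
  Path-ones (suc c) {t} {i} {Y} p = subst₂ (λ t i → Path t i (true ∷ Y)) (+-suc c t) (+-suc c i) (proj₁ rest) , cells
    where
    first : ∀ c {t i} → Path t i (true ∷ ones c ++ true ∷ Y) → Path (suc t) (suc i) (ones c ++ true ∷ Y)
    first zero    (up _ p) = p
    first (suc c) (up _ p) = p
    rest : Path (c + suc t) (c + suc i) (true ∷ Y) × (∀ y → y ≤ c → One (y + suc t) (y + suc i))
    rest = Path-ones c (first c p)
    cells : ∀ y → y ≤ suc c → One (y + t) (y + i)
    cells zero    _         = origin p
    cells (suc y) (s≤s y≤c) = subst₂ One (+-suc y t) (+-suc y i) (proj₂ rest y y≤c)

  -- A jump advances by `m + 1` columns, so within `m` columns of the right edge a snake can only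
  -- climb.
  climb-out : ∀ c {t i} → c ≤ m → N′ ≡ i + c → One t i → Path t i (ones (suc c))
  climb-out zero    {i = i} _ eq o = end (sym (trans eq (+-identityʳ i))) o
  climb-out (suc c) {t} {i} c<m eq o = up o (climb-out c (<⇒≤ c<m) (trans eq (+-suc i c))
    (climb o (≤-trans (m≤m+n (suc i) c) (≤-reflexive (sym (trans eq (+-suc i c)))))
      (λ o′ → 1+n≰n (≤-trans (≤-trans (+-monoʳ-< i (s≤s c<m)) (range o′)) (≤-reflexive eq)))))

  -- The snake through (t , L + i) is the translate of the one through (t + 2 , i) until it ends.
  parallel : ∀ {L e} → N′ ≡ L + e → m ≤ L → L ≤ m + m →
    ∀ {t i′ i Y} → Path t i′ Y → i′ ≡ L + i → One (2 + t) i →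
    ∃ λ t₁ → One t₁ N′ × One (2 + t₁) e × (∀ {w} → Path (2 + t₁) e (true ∷ w) → Path (2 + t) i (Y ++ w))
  parallel {L} {e} N′≡ m≤L L≤2m = go
    where
    go : ∀ {t i′ i Y} → Path t i′ Y → i′ ≡ L + i → One (2 + t) i →
      ∃ λ t₁ → One t₁ N′ × One (2 + t₁) e × (∀ {w} → Path (2 + t₁) e (true ∷ w) → Path (2 + t) i (Y ++ w))
    go {t} {i = i} (end refl o) i′≡ o₂ with +-cancelˡ-≡ L i e (trans (sym i′≡) N′≡)
    ... | refl = t , o , o₂ , λ q → q
    go {t} {i = i} (up o p) refl o₂ with go p (sym (+-suc L i)) climbed
      where
      climbed : One (3 + t) (suc i)
      -- The bounds on `L` put the first snake's one at `(t + 1 , L + i + 1)` into the range that a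
      -- one at `(t + 2 , i + m + 1)` would exclude, so the translate cannot jump.
      climbed = climb o₂ (≤-trans (s≤s (m≤n+m i L)) (range (origin p))) (λ o₂′ → vert o₂′ (origin p)
        (≤-trans (≤-reflexive (+-comm i (suc m))) (s≤s (+-monoˡ-≤ i m≤L)))
        (≤-trans (s≤s (+-monoˡ-≤ i L≤2m)) (≤-reflexive (shuffle m i))))
        where
        shuffle : ∀ m i → suc (m + m + i) ≡ i + suc m + m
        shuffle = solve-∀
    ... | t₁ , o₁ , o₁′ , extend = t₁ , o₁ , o₁′ , λ q → up o₂ (extend q)
    go {t} {i = i} (jump {v = v} {w = Y} o v≡ p) refl o₂ with go p (+-assoc L i (suc m)) jumped
      where
      p′ : One t (L + (i + suc m))
      p′ = subst (One t) (+-assoc L i (suc m)) (origin p)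
      jumped : One (2 + t) (i + suc m)
      jumped = fill (≤-trans (m≤n+m (i + suc m) L) (range p′)) old new
        where
        -- A one of row `t + 1` in the way would conflict with one of the two ends of the first
        -- snake's jump, `(t , L + i)` or `(t , L + i + m + 1)`.
        old : ∀ j → i + suc m ≤ j → j ≤ i + suc m + m → ¬ One (suc t) j
        old j ≤j j≤ o₁ with j ≤? L + i
        ... | yes j≤L+i = vert o₁ o j≤L+i (≤-trans (+-monoˡ-≤ i L≤2m) (≤-trans (n≤1+n _)
                            (≤-trans (≤-reflexive (shuffle m i)) (+-monoˡ-≤ m ≤j))))
          where
          shuffle : ∀ m i → suc (m + m + i) ≡ i + suc m + m
          shuffle = solve-∀
        ... | no  j≰L+i = vert o₁ p′ (≤-trans j≤ (≤-trans (≤-reflexive (+-comm (i + suc m) m)) (+-monoˡ-≤ (i + suc m) m≤L)))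
                            (≤-trans (≤-reflexive (shuffle L i m)) (+-monoˡ-≤ m (≰⇒> j≰L+i)))
          where
          shuffle : ∀ L i m → L + (i + suc m) ≡ suc (L + i) + m
          shuffle = solve-∀
        new : ∀ j → j < i + suc m → i + suc m ≤ j + m → ¬ One (2 + t) j
        new j j< ≤j+m o₂′ = indep o₂ o₂′ (+-cancelʳ-≤ m (suc i) j (≤-trans (≤-reflexive (sym (+-suc i m))) ≤j+m))
          (≤-pred (≤-trans j< (≤-reflexive (+-suc i m))))
    ... | t₁ , o₁ , o₁′ , extend = t₁ , o₁ , o₁′ , λ {w} q →
            jump o₂ (trans (cong (_++ w) v≡) (++-assoc (zeros m) Y w)) (extend q)

  -- The number of rows between the starts of consecutive snakes, read off from the first block.
  -- `blockColumns` is the length of that block, hence the horizontal distance between the two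
  -- parallel snakes.
  gap : Bool → ℕ → ℕ
  gap true  r = 2 + r
  gap false _ = 2 + m

  blockColumns : Bool → ℕ → ℕ
  blockColumns true  r = suc r + m
  blockColumns false _ = m

  -- `row` rows after its start the snake has passed its first block and stands in column
  -- `blockColumns b r`; the next snake starts two rows later.
  record NextStart (b : Bool) (r t : ℕ) (Y : List Bool) : Set where
    field
      row     : ℕ
      two     : gap b r ≡ 2 + row
      rest    : Path (row + t) (blockColumns b r) (true ∷ Y)
      start   : One (2 + row + t) 0
      between : ∀ y → y ≤ row → ¬ One (suc (y + t)) 0

  nextStart : ∀ b {r t Y} → r < m → Path t 0 (headBlock m b r ++ true ∷ Y) → NextStart b r t Y
  nextStart false {r} {t} {Y} _ p = record
    { row     = m
    ; two     = refl
    ; rest    = subst (λ i → Path (m + t) i (true ∷ Y)) (+-identityʳ m) (proj₁ climbed)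
    -- A one of row `m + 1 + t` in columns 0 to `m` would conflict with `(m + t , m)`, and column 0
    -- has nothing on its left.
    ; start   = fill z≤n (λ j _ j≤m o → vert o (cell m ≤-refl) j≤m (m≤n+m m j)) (λ j ())
    ; between = λ y y≤m o → vert o (cell y y≤m) z≤n y≤m
    }
    where
    climbed : Path (m + t) (m + 0) (true ∷ Y) × (∀ y → y ≤ m → One (y + t) (y + 0))
    climbed = Path-ones m p
    cell : ∀ y → y ≤ m → One (y + t) y
    cell y y≤m = subst (One (y + t)) (+-identityʳ y) (proj₂ climbed y y≤m)
  nextStart true {r} {t} {Y} r<m p = record
    { row     = r
    ; two     = refl
    ; rest    = landed
    ; start   = fill z≤n below-landing (λ j ())
    ; between = λ y y≤r o → vert o (cell y y≤r) z≤n (≤-trans y≤r r≤m)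
    }
    where
    r≤m : r ≤ m
    r≤m = <⇒≤ r<m
    shape : ∀ r → headBlock m true r ++ true ∷ Y ≡ ones r ++ true ∷ zeros m ++ true ∷ Y
    shape zero    = refl
    shape (suc r) = cong (true ∷_) (shape r)
    climbed : Path (r + t) (r + 0) (true ∷ zeros m ++ true ∷ Y) × (∀ y → y ≤ r → One (y + t) (y + 0))
    climbed = Path-ones r (subst (Path t 0) (shape r) p)
    cell : ∀ y → y ≤ r → One (y + t) y
    cell y y≤r = subst (One (y + t)) (+-identityʳ y) (proj₂ climbed y y≤r)
    landed : Path (r + t) (suc r + m) (true ∷ Y)
    landed = subst (λ i → Path (r + t) i (true ∷ Y)) (trans (cong (_+ suc m) (+-identityʳ r)) (+-suc r m))
      (Path-jump (proj₁ climbed))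
    -- Columns up to `r` are excluded by the foot of the jump, those from `r + 1` to `m` by its
    -- landing point.
    below-landing : ∀ j → 0 ≤ j → j ≤ m → ¬ One (suc r + t) j
    below-landing j _ j≤m o with j ≤? r
    ... | yes j≤r = vert o (cell r ≤-refl) j≤r (≤-trans r≤m (m≤n+m m j))
    ... | no  j≰r = vert o (origin landed) (≤-trans j≤m (m≤n+m m (suc r))) (+-monoˡ-≤ m (≰⇒> j≰r))

  -- The translate runs until the first snake reaches column `N′`, that is, up to column `e`, with
  -- `L` columns left. These hold the first block reversed: a climb of `m` columns, or a jump
  -- followed by a climb of `r`.
  nextPath : ∀ b {r t Y} → r < m → Path t 0 (headBlock m b r ++ true ∷ Y) →
    Path (gap b r + t) 0 (true ∷ Y ++ tailBlock m b r) × (∀ y → suc y < gap b r → ¬ One (suc y + t) 0)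
  nextPath b {r} {t} {Y} r<m p =
    subst (λ g → Path (g + t) 0 (true ∷ Y ++ tailBlock m b r)) (sym two) path ,
    λ y y<gap → between y (≤-pred (≤-pred (≤-trans y<gap (≤-reflexive two))))
    where
    open NextStart (nextStart b r<m p)
    L e : ℕ
    L = blockColumns b r
    e = N′ ∸ L
    N′≡ : N′ ≡ L + e
    N′≡ = sym (m+[n∸m]≡n (range (origin rest)))
    m≤L : ∀ b → m ≤ blockColumns b r
    m≤L true  = m≤n+m m (suc r)
    m≤L false = ≤-refl
    L≤2m : ∀ b → blockColumns b r ≤ m + m
    L≤2m true  = +-monoˡ-≤ m r<m
    L≤2m false = m≤m+n m m
    last : ∀ b {t₁} → N′ ≡ blockColumns b r + e → One t₁ N′ → One (2 + t₁) e → ∃ λ w →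
      true ∷ w ≡ true ∷ tailBlock m b r × Path (2 + t₁) e (true ∷ w)
    last false N′≡ _ o = _ , refl , climb-out m ≤-refl (trans N′≡ (+-comm m e)) o
    last true {t₁} N′≡ o₁ o = _ , refl , jump o refl (climb-out r (<⇒≤ r<m) top corner)
      where
      shuffle : ∀ r m e → suc r + m + e ≡ e + suc m + r
      shuffle = solve-∀
      top : N′ ≡ e + suc m + r
      top = trans N′≡ (shuffle r m e)
      corner : One (2 + t₁) (e + suc m)
      -- Since `r < m`, the one at `(t₁ , N′)` excludes every one of row `t₁ + 1` from column
      -- `e + m + 1` on. In row `t₁ + 2` the one at `e` excludes ones just before the landing point.
      corner = fill (≤-trans (m≤m+n (e + suc m) r) (≤-reflexive (sym top))) old new
        where
        old : ∀ j → e + suc m ≤ j → j ≤ e + suc m + m → ¬ One (suc t₁) j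
        old j ≤j _ o′ = vert o′ o₁ (range o′)
          (≤-trans (≤-reflexive top) (≤-trans (+-monoʳ-≤ (e + suc m) (<⇒≤ r<m)) (+-monoˡ-≤ m ≤j)))
        new : ∀ j → j < e + suc m → e + suc m ≤ j + m → ¬ One (2 + t₁) j
        new j j< ≤j+m o′ = indep o o′ (+-cancelʳ-≤ m (suc e) j (≤-trans (≤-reflexive (sym (+-suc e m))) ≤j+m))
          (≤-pred (≤-trans j< (≤-reflexive (+-suc e m))))
    path : Path (2 + row + t) 0 (true ∷ Y ++ tailBlock m b r)
    path with parallel N′≡ (m≤L b) (L≤2m b) rest (sym (+-identityʳ L)) start
    ... | t₁ , o₁ , o₁′ , extend with last b N′≡ o₁ o₁′
    ...   | _ , refl , q = extend q

  -- Without either predecessor nothing keeps `(t + 1 , i)` empty, since the one at `i + 1` excludes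
  -- everything else that could block it. But a one there would be too close to `i + 1`.
  no-predecessor : ∀ {t i} → One (suc t) (suc i) → ¬ One t i → ¬ (∀ j → i ≡ j + m → ¬ One (suc t) j)
  no-predecessor {t} {i} o ¬o no-jump =
    indep (fill (<⇒≤ (range o)) old new) o ≤-refl (≤-trans (≤-reflexive (+-comm 1 i)) (+-monoʳ-≤ i (s≤s z≤n)))
    where
    old : ∀ j → i ≤ j → j ≤ i + m → ¬ One t j
    old j i≤j j≤ o′ with m≤n⇒m<n∨m≡n i≤j
    ... | inj₁ i<j  = vert o o′ i<j (≤-trans j≤ (n≤1+n _))
    ... | inj₂ refl = ¬o o′
    new : ∀ j → j < i → i ≤ j + m → ¬ One (suc t) j
    new j j<i i≤j+m o′ with m≤n⇒m<n∨m≡n i≤j+m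
    ... | inj₁ i<j+m = indep o′ o (s≤s (<⇒≤ j<i)) i<j+m
    ... | inj₂ i≡j+m = no-jump j i≡j+m o′

  Path-length : ∀ {t i w} → Path t i w → i + length w ≡ suc N′
  Path-length {i = i} (end refl _) = +-comm i 1
  Path-length {i = i} (up {w = w} _ p) = trans (+-suc i (length w)) (Path-length p)
  Path-length {i = i} (jump {w = w} _ refl p) = trans (cong (λ l → i + suc l) (trans (length-++ (zeros m)) (cong (_+ length w) (length-replicate m))))
    (trans (sym (+-assoc i (suc m) (length w))) (Path-length p))

  -- Counting a column by the snakes that pass through it

  abstract
    -- 1 if the snake from `(t , i)` on has a one in column `c`, and 0 if it has none or there is no
    -- one at `(t , i)`.
    hit : ℕ → ℕ → ℕ → ℕ
    hit c t i with a t i Bool.≟ true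
    ... | yes o = at (zeros i ++ proj₁ (follow o)) c
    ... | no  _ = 0

    hit-Path : ∀ c {t i w} → Path t i w → hit c t i ≡ at (zeros i ++ w) c
    hit-Path c {t} {i} p with a t i Bool.≟ true
    ... | yes o  = cong (λ w → at (zeros i ++ w) c) (Path-unique (proj₂ (follow o)) p)
    ... | no  ¬o = ⊥-elim (¬o (origin p))

    hit-none : ∀ c {t i} → ¬ One t i → hit c t i ≡ 0
    hit-none c {t} {i} ¬o with a t i Bool.≟ true
    ... | yes o = ⊥-elim (¬o o)
    ... | no  _ = refl

    hit-beyond : ∀ {c t i} → c < i → hit c t i ≡ 0
    hit-beyond {c} {t} {i} c<i with a t i Bool.≟ true
    ... | yes o = at-zeros i c c<i
      where
      at-zeros : ∀ i c {w} → c < i → at (zeros i ++ w) c ≡ 0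
      at-zeros (suc i) zero    _         = refl
      at-zeros (suc i) (suc c) (s≤s c<i) = at-zeros i c c<i
    ... | no  _ = refl

  hit-here : ∀ c t → hit c t c ≡ val (a t c)
  hit-here c t with a t c in eq
  ... | true  = trans (hit-Path c (proj₂ (follow eq))) (at-start (proj₂ (follow eq)))
    where
    at-end : ∀ i {w} → at (zeros i ++ true ∷ w) i ≡ 1
    at-end zero    = refl
    at-end (suc i) = at-end i
    at-start : ∀ {t i w} → Path t i w → at (zeros i ++ w) i ≡ 1
    at-start {i = i} (end _ _)    = at-end i
    at-start {i = i} (up _ _)     = at-end i
    at-start {i = i} (jump _ _ _) = at-end i
  ... | false = hit-none c (λ o → case trans (sym o) eq of λ ())

  at-skip : ∀ {b w} i c → i < c → at (zeros i ++ b ∷ w) c ≡ at (zeros (suc i) ++ w) c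
  at-skip zero    (suc c) _         = refl
  at-skip (suc i) (suc c) (s≤s i<c) = at-skip i c i<c

  -- A snake that has not yet reached column `c` continues to exactly one of its two possible
  -- successors, so at most one summand is nonzero.
  hit-step : ∀ {c} → c ≤ N′ → ∀ t i → i < c →
    hit c t i ≡ val (a t i) * hit c (suc t) (suc i) + val (a t i) * hit c t (i + suc m)
  hit-step {c} c≤N′ t i i<c with a t i in eq
  ... | false = hit-none c (λ o → case trans (sym o) eq of λ ())
  ... | true  = along (proj₂ (follow eq))
    where
    along : ∀ {w} → Path t i w → hit c t i ≡ 1 * hit c (suc t) (suc i) + 1 * hit c t (i + suc m)
    along (end refl _) = ⊥-elim (1+n≰n (≤-trans i<c c≤N′))
    along p@(up {w = w} _ p′) = begin
      hit c t i                                            ≡⟨ hit-Path c p ⟩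
      at (zeros i ++ true ∷ w) c                           ≡⟨ at-skip i c i<c ⟩
      at (zeros (suc i) ++ w) c                            ≡⟨ hit-Path c p′ ⟨
      hit c (suc t) (suc i)                                ≡⟨ shuffle (hit c (suc t) (suc i)) ⟩
      1 * hit c (suc t) (suc i) + 1 * 0                    ≡⟨ cong (λ h → 1 * hit c (suc t) (suc i) + 1 * h)
                                                                (hit-none c (λ o → not-both o (origin p′))) ⟨
      1 * hit c (suc t) (suc i) + 1 * hit c t (i + suc m)  ∎
      where
      shuffle : ∀ h → h ≡ 1 * h + 1 * 0
      shuffle = solve-∀
    along p@(jump {w = w} _ refl p′) = begin
      hit c t i                                            ≡⟨ hit-Path c p ⟩
      at (zeros i ++ true ∷ zeros m ++ w) c                ≡⟨ at-skip i c i<c ⟩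
      at (zeros (suc i) ++ zeros m ++ w) c                 ≡⟨ cong (λ u → at u c) (++-assoc (zeros (suc i)) (zeros m) w) ⟨
      at ((zeros (suc i) ++ zeros m) ++ w) c               ≡⟨ cong (λ u → at (u ++ w) c) (zeros-+ (suc i) m) ⟨
      at (zeros (suc i + m) ++ w) c                        ≡⟨ cong (λ n → at (zeros n ++ w) c) (+-suc i m) ⟨
      at (zeros (i + suc m) ++ w) c                        ≡⟨ hit-Path c p′ ⟨
      hit c t (i + suc m)                                  ≡⟨ shuffle (hit c t (i + suc m)) ⟩
      1 * 0 + 1 * hit c t (i + suc m)                      ≡⟨ cong (λ h → 1 * h + 1 * hit c t (i + suc m))
                                                                (hit-none c (not-both (origin p′))) ⟨
      1 * hit c (suc t) (suc i) + 1 * hit c t (i + suc m)  ∎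
      where
      shuffle : ∀ h → h ≡ 1 * 0 + 1 * h
      shuffle = solve-∀

  hit-step-back : ∀ c t i → (∀ j → i ≡ j + m → ¬ One (suc t) j) →
    hit c (suc t) (suc i) ≡ val (a t i) * hit c (suc t) (suc i)
  hit-step-back c t i no-jump with a t i in eq
  ... | true  = sym (+-identityʳ _)
  ... | false = hit-none c (λ o → no-predecessor o (λ o′ → case trans (sym o′) eq of λ ()) no-jump)

  -- The two possible predecessors, a climb from row `t` and a jump within row `t + 1`, exclude each
  -- other by `vert`.
  hit-jump-back : ∀ c t j → hit c (suc t) (suc (j + m)) ≡
    val (a t (j + m)) * hit c (suc t) (suc (j + m)) + val (a (suc t) j) * hit c (suc t) (j + suc m)
  hit-jump-back c t j with a (suc t) j in eq
  ... | false = trans (hit-step-back c t (j + m) λ j′ j+m≡ o →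
                  case trans (sym o) (trans (cong (a (suc t)) (sym (+-cancelʳ-≡ m j j′ j+m≡))) eq) of λ ()) (sym (+-identityʳ _))
  ... | true  with a t (j + m) in eq′
  ...   | true  = ⊥-elim (vert eq eq′ (m≤m+n j m) ≤-refl)
  ...   | false = trans (cong (hit c (suc t)) (sym (+-suc j m))) (sym (+-identityʳ _))

  -- Conservation of snakes over one period

  module Period {q : ℕ} (periodic : ∀ i → Periodic q (λ t → a t i)) where

    Path-periodic : ∀ {t i w} → Path t i w → Path (q + t) i w
    Path-periodic {t} {i} (end eq o)    = end eq (trans (periodic i t) o)
    Path-periodic {t} {i} (up {w = w} o p) =
      up (trans (periodic i t) o) (subst (λ t → Path t (suc i) w) (+-suc q t) (Path-periodic p))
    Path-periodic {t} {i} (jump o eq p) = jump (trans (periodic i t) o) eq (Path-periodic p)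

    hit-periodic : ∀ c i → Periodic q (λ t → hit c t i)
    hit-periodic c i t with a t i in eq
    ... | true  = trans (hit-Path c (Path-periodic (proj₂ (follow eq)))) (sym (hit-Path c (proj₂ (follow eq))))
    ... | false = trans (hit-none c (¬o ∘ trans (sym (periodic i t)))) (sym (hit-none c ¬o))
      where
      ¬o : ¬ One t i
      ¬o o = case trans (sym o) eq of λ ()

    module _ (c : ℕ) (c≤N′ : c ≤ N′) where

      total climbing jumping : ℕ → ℕ
      total    i = sumTo q (λ t → hit c t i)
      climbing i = sumTo q (λ t → val (a t i) * hit c (suc t) (suc i))
      jumping  i = sumTo q (λ t → val (a t i) * hit c t (i + suc m))

      total-step : ∀ i → i < c → total i ≡ climbing i + jumping i
      total-step i i<c = trans (sumTo-cong q (λ t → hit-step c≤N′ t i i<c)) (sumTo-+ q _ _)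

      total-suc : ∀ i → total (suc i) ≡ sumTo q (λ t → hit c (suc t) (suc i))
      total-suc i = sym (sumTo-shift (hit-periodic c (suc i)) 1)

      total-step-back : ∀ i → i < m → total (suc i) ≡ climbing i
      total-step-back i i<m = trans (total-suc i) (sumTo-cong q (λ t → hit-step-back c t i
        (λ j i≡j+m _ → 1+n≰n (≤-trans i<m (≤-trans (m≤n+m m j) (≤-reflexive (sym i≡j+m)))))))

      total-jump-back : ∀ j → total (suc (j + m)) ≡ climbing (j + m) + jumping j
      total-jump-back j = begin
        total (suc (j + m))
          ≡⟨ total-suc (j + m) ⟩
        sumTo q (λ t → hit c (suc t) (suc (j + m)))
          ≡⟨ trans (sumTo-cong q (λ t → hit-jump-back c t j)) (sumTo-+ q _ _) ⟩
        climbing (j + m) + sumTo q (λ t → val (a (suc t) j) * hit c (suc t) (j + suc m))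
          ≡⟨ cong (climbing (j + m) +_) (sumTo-shift (λ t →
               cong₂ _*_ (cong val (periodic j t)) (hit-periodic c (j + suc m) t)) 1) ⟩
        climbing (j + m) + jumping j ∎

      -- The snakes counted in column 0 either have a one in column `i` or jump over it from one of
      -- the `m` columns before it. The difference of the two sums of `jumping` counts the latter.
      flow : ∀ i → i ≤ c → total 0 + sumTo (i ∸ m) jumping ≡ total i + sumTo i jumping
      flow zero    _   = refl
      flow (suc i) i<c with i <? m
      ... | yes i<m = begin
        total 0 + sumTo (suc i ∸ m) jumping            ≡⟨ cong (λ n → total 0 + sumTo n jumping) (trans (m≤n⇒m∸n≡0 i<m) (sym (m≤n⇒m∸n≡0 (<⇒≤ i<m)))) ⟩
        total 0 + sumTo (i ∸ m) jumping                ≡⟨ flow i (<⇒≤ i<c) ⟩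
        total i + sumTo i jumping                      ≡⟨ cong (_+ sumTo i jumping) (total-step i i<c) ⟩
        climbing i + jumping i + sumTo i jumping       ≡⟨ shuffle (climbing i) _ _ ⟩
        climbing i + sumTo (suc i) jumping             ≡⟨ cong (_+ sumTo (suc i) jumping) (total-step-back i i<m) ⟨
        total (suc i) + sumTo (suc i) jumping          ∎
        where
        shuffle : ∀ a b c → a + b + c ≡ a + (c + b)
        shuffle = solve-∀
      ... | no i≮m = begin
        total 0 + sumTo (suc i ∸ m) jumping            ≡⟨ cong (λ n → total 0 + sumTo n jumping) (+-∸-assoc 1 (≮⇒≥ i≮m)) ⟩
        total 0 + (sumTo j jumping + jumping j)        ≡⟨ +-assoc (total 0) _ _ ⟨
        total 0 + sumTo j jumping + jumping j          ≡⟨ cong (_+ jumping j) (flow i (<⇒≤ i<c)) ⟩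
        total i + sumTo i jumping + jumping j          ≡⟨ cong (λ y → y + sumTo i jumping + jumping j) (total-step i i<c) ⟩
        climbing i + jumping i + sumTo i jumping + jumping j
                                                       ≡⟨ shuffle (climbing i) _ _ _ ⟩
        climbing i + jumping j + sumTo (suc i) jumping ≡⟨ cong (_+ sumTo (suc i) jumping) back ⟨
        total (suc i) + sumTo (suc i) jumping          ∎
        where
        j : ℕ
        j = i ∸ m
        i≡ : j + m ≡ i
        i≡ = m∸n+n≡m (≮⇒≥ i≮m)
        back : total (suc i) ≡ climbing i + jumping j
        back = trans (cong (total ∘ suc) (sym i≡)) (trans (total-jump-back j) (cong (λ i → climbing i + jumping j) i≡))
        shuffle : ∀ a b c d → a + b + c + d ≡ a + d + (c + b)
        shuffle = solve-∀

      -- A jump from column `c ∸ m` or later lands beyond `c`, so its snake is not counted. At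
      -- `i = c` the two jump sums in `flow` therefore agree.
      no-jumping : ∀ j → jumping (c ∸ m + j) ≡ 0
      no-jumping j = sumTo-0 q (λ t _ → trans (cong (val (a t (c ∸ m + j)) *_) (hit-beyond beyond)) (*-zeroʳ (val (a t (c ∸ m + j)))))
        where
        beyond : c < c ∸ m + j + suc m
        beyond = ≤-trans (s≤s (≤-trans (m≤n+m∸n c m) (≤-trans (≤-reflexive (+-comm m (c ∸ m)))
          (+-monoˡ-≤ m (m≤m+n (c ∸ m) j))))) (≤-reflexive (sym (+-suc (c ∸ m + j) m)))

      column-sum : sumTo q (λ t → val (a t c)) ≡ sumTo q (λ t → hit c t 0)
      column-sum = begin
        sumTo q (λ t → val (a t c))   ≡⟨ sumTo-cong q (λ t → hit-here c t) ⟨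
        total c                       ≡⟨ +-cancelʳ-≡ (sumTo c jumping) _ _ (trans (sym (flow c ≤-refl)) (cong (total 0 +_) jumps)) ⟩
        total 0                       ∎
        where
        jumps : sumTo (c ∸ m) jumping ≡ sumTo c jumping
        jumps = begin
          sumTo (c ∸ m) jumping
            ≡⟨ +-identityʳ _ ⟨
          sumTo (c ∸ m) jumping + 0
            ≡⟨ cong (sumTo (c ∸ m) jumping +_) (sumTo-0 (c ∸ (c ∸ m)) (λ j _ → no-jumping j)) ⟨
          sumTo (c ∸ m) jumping + sumTo (c ∸ (c ∸ m)) (λ j → jumping (c ∸ m + j))
            ≡⟨ sumTo-++ (c ∸ m) (c ∸ (c ∸ m)) jumping ⟨
          sumTo (c ∸ m + (c ∸ (c ∸ m))) jumping
            ≡⟨ cong (λ n → sumTo n jumping) (m+[n∸m]≡n (m∸n≤m c m)) ⟩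
          sumTo c jumping ∎

-- Successive snakes

word-cong : ∀ m {P P′ ρ ρ′} n p p′ x x′ → (∀ j → j < n → P (p + j) ≡ P′ (p′ + j)) →
  (∀ j → j ≤ Word.W m P ρ p n → ρ (x + j) ≡ ρ′ (x′ + j)) →
  Word.word m P ρ n p x ≡ Word.word m P′ ρ′ n p′ x′
word-cong m {ρ = ρ} {ρ′} zero p p′ x x′ P≗ ρ≗ = cong (ones ∘ suc)
  (trans (cong ρ (sym (+-identityʳ x))) (trans (ρ≗ 0 z≤n) (cong ρ′ (+-identityʳ x′))))
word-cong m {P} {P′} {ρ} {ρ′} (suc n) p p′ x x′ P≗ ρ≗ = cong₂ _++_
  (cong₂ (headBlock m) P≡ ρ≡)
  (trans (word-cong m n (suc p) (suc p′) (val (P p) + x) (val (P p) + x′)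
    (λ j j<n → trans (cong P (sym (+-suc p j))) (trans (P≗ (suc j) (s≤s j<n)) (cong P′ (+-suc p′ j))))
    (λ j j≤ → trans (cong ρ (shuffle (val (P p)) x j)) (trans
      (ρ≗ (val (P p) + j) (≤-trans (+-monoʳ-≤ (val (P p)) j≤) (≤-reflexive (sym (Word.W-head m P ρ p n)))))
      (cong ρ′ (sym (shuffle (val (P p)) x′ j))))))
    (cong (λ b → Word.word m P′ ρ′ n (suc p′) (val b + x′)) P≡))
  where
  shuffle : ∀ v x j → v + x + j ≡ x + (v + j)
  shuffle = solve-∀
  P≡ : P p ≡ P′ p′
  P≡ = trans (cong P (sym (+-identityʳ p))) (trans (P≗ 0 (s≤s z≤n)) (cong P′ (+-identityʳ p′)))
  ρ≡ : ρ x ≡ ρ′ x′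
  ρ≡ = trans (cong ρ (sym (+-identityʳ x))) (trans (ρ≗ 0 z≤n) (cong ρ′ (+-identityʳ x′)))

word-head : ∀ μ P ρ n p x → ∃ λ Y → Word.word (suc μ) P ρ n p x ≡ true ∷ Y
word-head μ P ρ zero    p x = _ , refl
word-head μ P ρ (suc n) p x with P p
... | true  = _ , refl
... | false = _ , refl

record Parse (m : ℕ) (w : List Bool) : Set where
  constructor parsed
  field
    n       : ℕ
    P       : ℕ → Bool
    ρ       : ℕ → ℕ
    bounded : ∀ x → ρ x < m
    parses  : w ≡ Word.word m P ρ n 0 0

infixr 5 _◃_
_◃_ : {A : Set} → A → (ℕ → A) → ℕ → A
(x ◃ f) zero    = x
(x ◃ f) (suc i) = f i

parse-unit : ∀ {m w} → Parse m w → Parse m (ones m ++ w)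
parse-unit {m} (parsed n P ρ bounded parses) = parsed (suc n) (false ◃ P) ρ bounded
  (cong (ones m ++_) (trans parses (word-cong m n 0 1 0 0 (λ _ _ → refl) (λ _ _ → refl))))

parse-run : ∀ {m w} r → r < m → Parse m w → Parse m (ones (suc r) ++ zeros m ++ w)
parse-run {m} {w} r r<m (parsed n P ρ bounded parses) = parsed (suc n) (true ◃ P) (r ◃ ρ)
  (λ { zero → r<m ; (suc x) → bounded x })
  (trans (sym (++-assoc (ones (suc r)) (zeros m) w)) (cong ((ones (suc r) ++ zeros m) ++_)
    (trans parses (word-cong m n 0 1 0 1 (λ _ _ → refl) (λ _ _ → refl)))))

ones-snoc : ∀ j (w : List Bool) → ones j ++ true ∷ w ≡ ones (suc j) ++ w
ones-snoc zero    w = refl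
ones-snoc (suc j) w = cong (true ∷_) (ones-snoc j w)

-- A parse with both sequences made periodic. There are `suc K` blocks and `suc k` runs, the final
-- run included.
record Cycle (m : ℕ) (w : List Bool) : Set where
  field
    K k       : ℕ
    P         : ℕ → Bool
    ρ         : ℕ → ℕ
    bounded   : ∀ x → ρ x < m
    periodicP : Periodic (suc K) P
    periodicρ : Periodic (suc k) ρ
    count     : Word.W m P ρ 0 (suc K) ≡ k
    spells    : w ≡ Word.word m P ρ (suc K) 0 0

%-periodic : ∀ {A : Set} n (f : ℕ → A) → Periodic (suc n) (λ i → f (i % suc n))
%-periodic n f t = cong f (trans (cong (_% suc n) (+-comm (suc n) t)) ([m+n]%n≡m%n t (suc n)))

cycle : ∀ {m w} → m < length w → Parse m w → Cycle m w
cycle {m} m<|w| (parsed zero P ρ bounded refl) =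
  -- Without blocks the word would be a single run of at most `m` ones.
  ⊥-elim (1+n≰n (≤-trans m<|w| (≤-trans (≤-reflexive (length-replicate (suc (ρ 0)))) (bounded 0))))
cycle {m} {w} _ (parsed (suc K) P ρ bounded parses) = record
  { K         = K
  ; k         = k
  ; P         = λ i → P (i % suc K)
  ; ρ         = λ i → ρ (i % suc k)
  ; bounded   = λ x → bounded (x % suc k)
  ; periodicP = %-periodic K P
  ; periodicρ = %-periodic k ρ
  ; count     = sumTo-cong< (suc K) (λ j j<K → cong (val ∘ P) (m<n⇒m%n≡m j<K))
  ; spells    = trans parses (word-cong m (suc K) 0 0 0 0
                  (λ j j<K → cong P (sym (m<n⇒m%n≡m j<K))) (λ j j≤k → cong ρ (sym (m<n⇒m%n≡m (s≤s j≤k)))))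
  }
  where
  k : ℕ
  k = Word.W m P ρ 0 (suc K)

module Orbit {μ N′ : ℕ} {a : ℕ → ℕ → Bool} (isBoard : IsBoard (suc μ) N′ a) where

  open Board μ N′ a isBoard

  -- Reads the snake greedily, with `j` ones pending since the last complete block. At `m` ones a
  -- block `1^m` is complete; a jump or the end of the snake closes a run of `j + 1` ones.
  parsePath : ∀ j → j < m → ∀ {t i w} → Path t i w → Parse m (ones j ++ w)
  parsePath j j<m (end _ _) = parsed 0 (λ _ → true) (λ _ → j) (λ _ → j<m) (trans (ones-snoc j []) (++-identityʳ (ones (suc j))))
  parsePath j j<m (up {w = w} _ p) with suc j ≟ m
  ... | yes refl   = subst (Parse m) (sym (ones-snoc j w)) (parse-unit (parsePath 0 (s≤s z≤n) p))
  ... | no  1+j≢m  = subst (Parse m) (sym (ones-snoc j w)) (parsePath (suc j) (≤∧≢⇒< j<m 1+j≢m) p)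
  parsePath j j<m (jump {w = w} _ refl p) = subst (Parse m) (sym (ones-snoc j (zeros m ++ w)))
    (parse-run j j<m (parsePath 0 (s≤s z≤n) p))

  module _ {w : List Bool} (cyc : Cycle m w) where

    open Cycle cyc
    open Word m P ρ
    open Cyclic m (suc K) k P ρ periodicP periodicρ count

    step : ℕ → ℕ
    step s = gap (P s) (ρ (W 0 s))

    wordAt : ℕ → List Bool
    wordAt s = word (suc K) s (W 0 s)

    -- By `word-snoc`, the last block of the rotated word is block `suc p + K`, which by periodicity
    -- is block `p` again, now reversed. This matches `nextPath`.
    word-rotate : ∀ p x → word (suc K) (suc p) (val (P p) + x) ≡
      word K (suc p) (val (P p) + x) ++ tailBlock m (P p) (ρ x)
    word-rotate p x = trans (word-snoc K (suc p) x′) (cong (word K (suc p) x′ ++_)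
      (trans (cong (λ b → tailBlock m b r) (trans (cong (P ∘ suc) (+-comm p K)) (periodicP p))) (by (P p) refl)))
      where
      x′ r : ℕ
      x′ = val (P p) + x
      r  = ρ (x′ + suc (W (suc p) K))
      shuffle : ∀ x w → 1 + x + suc w ≡ suc (1 + w) + x
      shuffle = solve-∀
      by : ∀ b → P p ≡ b → tailBlock m b r ≡ tailBlock m b (ρ x)
      by false _  = refl
      by true  eq = cong (tailBlock m true) (begin
        ρ (val (P p) + x + suc (W (suc p) K))   ≡⟨ cong (λ b → ρ (val b + x + suc (W (suc p) K))) eq ⟩
        ρ (1 + x + suc (W (suc p) K))           ≡⟨ cong ρ (shuffle x (W (suc p) K)) ⟩
        ρ (suc (1 + W (suc p) K) + x)           ≡⟨ cong (λ b → ρ (suc (val b + W (suc p) K) + x)) eq ⟨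
        -- The `suc K` blocks from `p` on use up `k` runs; with the final run the index has made a
        -- full turn.
        ρ (suc (val (P p) + W (suc p) K) + x)   ≡⟨ cong (λ n → ρ (suc n + x)) (trans (sym (W-head p K)) (W-full p)) ⟩
        ρ (suc k + x)                           ≡⟨ periodicρ x ⟩
        ρ x                                     ∎)

    module _ {t₀ : ℕ} (path : Path t₀ 0 w) where

      advance : ∀ s {t} → Path t 0 (wordAt s) →
        Path (step s + t) 0 (wordAt (suc s)) × (∀ y → suc y < step s → ¬ One (suc y + t) 0)
      advance s {t} p with word-head μ P ρ K (suc s) (val (P s) + W 0 s)
      ... | Y , eq with nextPath (P s) (bounded (W 0 s)) (subst (Path t 0) (cong (headBlock m (P s) (ρ (W 0 s)) ++_) eq) p)
      ...   | p′ , between = subst (Path (step s + t) 0) (sym (begin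
        wordAt (suc s)
          ≡⟨ cong (word (suc K) (suc s)) (+-comm (W 0 s) (val (P s))) ⟩
        word (suc K) (suc s) (val (P s) + W 0 s)
          ≡⟨ word-rotate s (W 0 s) ⟩
        word K (suc s) (val (P s) + W 0 s) ++ tailBlock m (P s) (ρ (W 0 s))
          ≡⟨ cong (_++ tailBlock m (P s) (ρ (W 0 s))) eq ⟩
        true ∷ Y ++ tailBlock m (P s) (ρ (W 0 s)) ∎)) p′ , between

      time : ℕ → ℕ
      time s = sumTo s step

      pathAt : ∀ s → Path (time s + t₀) 0 (wordAt s)
      pathAt zero    = subst (Path t₀ 0) spells path
      pathAt (suc s) = subst (λ t → Path t 0 (wordAt (suc s))) (shuffle (step s) (time s) t₀) (proj₁ (advance s (pathAt s)))
        where
        shuffle : ∀ a b c → a + (b + c) ≡ b + a + c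
        shuffle = solve-∀

      gap-pred : ∀ b r → ∃ λ g → gap b r ≡ suc g
      gap-pred true  r = _ , refl
      gap-pred false r = _ , refl

      -- In the `step n` rows of lap `n`, the only start in column 0 is that of the snake spelling
      -- `wordAt n`, in the first row.
      sum-hits : ∀ c n → sumTo (time n) (λ y → hit c (y + t₀) 0) ≡ sumTo n (λ s → at (wordAt s) c)
      sum-hits c zero    = refl
      sum-hits c (suc n) = trans (sumTo-++ (time n) (step n) _) (cong₂ _+_ (sum-hits c n) (lap (gap-pred (P n) (ρ (W 0 n)))))
        where
        lap : ∃ (λ g → step n ≡ suc g) → sumTo (step n) (λ y → hit c (time n + y + t₀) 0) ≡ at (wordAt n) c
        lap (g , step≡) = begin
          sumTo (step n) (λ y → hit c (time n + y + t₀) 0)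
            ≡⟨ cong (λ g → sumTo g (λ y → hit c (time n + y + t₀) 0)) step≡ ⟩
          sumTo (suc g) (λ y → hit c (time n + y + t₀) 0)
            ≡⟨ sumTo-head g _ ⟩
          hit c (time n + 0 + t₀) 0 + sumTo g (λ y → hit c (time n + suc y + t₀) 0)
            ≡⟨ cong₂ _+_ (trans (cong (λ t → hit c (t + t₀) 0) (+-identityʳ (time n))) (hit-Path c (pathAt n)))
                 (sumTo-0 g (λ y y<g → trans (cong (λ t → hit c t 0) (shuffle (time n) y t₀))
                   (hit-none c (proj₂ (advance n (pathAt n)) y (≤-trans (s≤s y<g) (≤-reflexive (sym step≡))))))) ⟩
          at (wordAt n) c + 0
            ≡⟨ +-identityʳ _ ⟩
          at (wordAt n) c ∎
          where
          shuffle : ∀ a y t → a + suc y + t ≡ suc y + (a + t)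
          shuffle = solve-∀

      -- After `T` snakes both rotations are back: `suc k` turns of the blocks use up `suc k * k`
      -- runs, a multiple of `suc k`.
      T : ℕ
      T = suc k * suc K

      P-T : Periodic T P
      P-T = Periodic-* periodicP (suc k)

      ρ-T : Periodic T (λ s → ρ (W 0 s))
      ρ-T s = begin
        ρ (W 0 (T + s))          ≡⟨ cong ρ (W-multiple (suc k) s) ⟩
        ρ (suc k * k + W 0 s)    ≡⟨ cong (λ n → ρ (n + W 0 s)) (*-comm (suc k) k) ⟩
        ρ (k * suc k + W 0 s)    ≡⟨ Periodic-* periodicρ k (W 0 s) ⟩
        ρ (W 0 s)                ∎

      step-T : Periodic T step
      step-T s = cong₂ gap (P-T s) (ρ-T s)

      wordAt-T : Periodic T wordAt
      wordAt-T s = word-cong m (suc K) (T + s) s (W 0 (T + s)) (W 0 s)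
        (λ j _ → trans (cong P (+-assoc T s j)) (P-T (s + j)))
        (λ j _ → begin
          ρ (W 0 (T + s) + j)          ≡⟨ cong (λ n → ρ (n + j)) (W-multiple (suc k) s) ⟩
          ρ (suc k * k + W 0 s + j)    ≡⟨ cong ρ (shuffle k (W 0 s) j) ⟩
          ρ (k * suc k + (W 0 s + j))  ≡⟨ Periodic-* periodicρ k (W 0 s + j) ⟩
          ρ (W 0 s + j)                ∎)
        where
        shuffle : ∀ k w j → suc k * k + w + j ≡ k * suc k + (w + j)
        shuffle = solve-∀

      -- To avoid comparing the two periods, starts are counted over `time T * q` rows, which are
      -- `time T` periods of the board and `q` rounds through all rotations.
      hits-symmetric : ∀ {q} → (∀ i → Periodic q (λ t → a t i)) → ∀ i j → i + j ≡ N′ →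
        sumTo q (λ t → hit i t 0) ≡ sumTo q (λ t → hit j t 0)
      hits-symmetric {q} periodic i j i+j≡N′ = *-cancelˡ-≡ _ _ (time T) {{>-nonZero 0<time}} (begin
        time T * sumTo q (λ t → hit i t 0)        ≡⟨ both i ⟩
        q * sumTo T (λ s → at (wordAt s) i)       ≡⟨ cong (q *_) (word-symmetric i j fits) ⟩
        q * sumTo T (λ s → at (wordAt s) j)       ≡⟨ both j ⟨
        time T * sumTo q (λ t → hit j t 0)        ∎)
        where
        open Period periodic
        fits : suc (i + j) ≡ width
        fits = trans (cong suc i+j≡N′) (trans (sym (Path-length (pathAt 0))) (trans (length-word (suc K) 0 0) (len-full 0 0)))
        0<time : 0 < time T
        0<time with gap-pred (P 0) (ρ 0)
        ... | g , step≡ = ≤-trans (s≤s z≤n) (≤-trans (≤-reflexive (sym step≡))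
          (≤-trans (m≤m+n (step 0) _) (≤-reflexive (sym (sumTo-head (K + k * suc K) step)))))
        both : ∀ c → time T * sumTo q (λ t → hit c t 0) ≡ q * sumTo T (λ s → at (wordAt s) c)
        both c = begin
          time T * sumTo q (λ t → hit c t 0)
            ≡⟨ cong (time T *_) (sumTo-shift (hit-periodic c 0) t₀) ⟨
          time T * sumTo q (λ y → hit c (t₀ + y) 0)
            ≡⟨ sumTo-* (Periodic-shift (hit-periodic c 0) t₀) (time T) ⟨
          sumTo (time T * q) (λ y → hit c (t₀ + y) 0)
            ≡⟨ cong (λ n → sumTo n (λ y → hit c (t₀ + y) 0)) (trans (*-comm (time T) q) (sym (sumTo-* step-T q))) ⟩
          sumTo (time (q * T)) (λ y → hit c (t₀ + y) 0)
            ≡⟨ sumTo-cong (time (q * T)) (λ y → cong (λ t → hit c t 0) (+-comm t₀ y)) ⟩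
          sumTo (time (q * T)) (λ y → hit c (y + t₀) 0)
            ≡⟨ sum-hits c (q * T) ⟩
          sumTo (q * T) (λ s → at (wordAt s) c)
            ≡⟨ sumTo-* (λ s → cong (λ w → at w c) (wordAt-T s)) q ⟩
          q * sumTo T (λ s → at (wordAt s) c) ∎

  columns-symmetric : m ≤ N′ → ∀ {q} → (∀ i → Periodic q (λ t → a t i)) → ∀ i j → i + j ≡ N′ →
    sumTo q (λ t → val (a t i)) ≡ sumTo q (λ t → val (a t j))
  columns-symmetric m≤N′ {q} periodic i j i+j≡N′ = begin
    sumTo q (λ t → val (a t i))   ≡⟨ column-sum i (≤-trans (m≤m+n i j) (≤-reflexive i+j≡N′)) ⟩
    sumTo q (λ t → hit i t 0)     ≡⟨ starts ⟩
    sumTo q (λ t → hit j t 0)     ≡⟨ column-sum j (≤-trans (m≤n+m j i) (≤-reflexive i+j≡N′)) ⟨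
    sumTo q (λ t → val (a t j))   ∎
    where
    open Period periodic
    starts : sumTo q (λ t → hit i t 0) ≡ sumTo q (λ t → hit j t 0)
    starts with anyUpTo? (λ t → a t 0 Bool.≟ true) q
    -- With column 0 empty no snake starts there, and both sums vanish.
    ... | no  none = sumTo-cong< q (λ t t<q → trans (hit-none i (λ o → none (t , t<q , o))) (sym (hit-none j (λ o → none (t , t<q , o)))))
    ... | yes (t₀ , _ , o) with follow o
    ...   | w , p = hits-symmetric (cycle (≤-trans (s≤s m≤N′) (≤-reflexive (sym (Path-length p)))) (parsePath 0 (s≤s z≤n) p)) p periodic i j i+j≡N′

-- Toggling

allowedAt : (m : ℕ) {N : ℕ} → Vec Bool N → ℕ → Bool
allowedAt m {N} w i = if (i + m) <ᵇ N then windowSum w i (suc m) ≤ᵇ 1 else true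

okBelow : (m : ℕ) {N : ℕ} → Vec Bool N → ℕ → Bool
okBelow m w zero = true
okBelow m {N} w (suc i) = allowedAt m w i ∧ okBelow m w i

okBelow-unique : ∀ m (g : ∀ {N} → Vec Bool N → ℕ → Bool) → (∀ {N} (w : Vec Bool N) → g w 0 ≡ true) →
  (∀ {N} (w : Vec Bool N) i → g w (suc i) ≡ (allowedAt m w i ∧ g w i)) →
  ∀ {N} (w : Vec Bool N) k → g w k ≡ okBelow m w k
okBelow-unique m g z s w zero = z w
okBelow-unique m g z s {N} w (suc k) = trans (s w k) (cong (_ ∧_) (okBelow-unique m g z s w k))

unfold : ∀ m k (w : Vec Bool (suc k)) → ∃ λ b → inXb m w ≡ (allowedAt m w k ∧ b)
unfold m k w = _ , refl

-- The local function go of inXb cannot be named. Abstracting the length and the word separately from the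
-- position k turns it into the solution of a unification problem.
mutual
  inXbBelow : (m : ℕ) {N : ℕ} → Vec Bool N → ℕ → Bool
  inXbBelow = _

  unfold-inXbBelow : ∀ m k (w : Vec Bool (suc k)) → proj₁ (unfold m k w) ≡ okBelow m w k
  unfold-inXbBelow m k w with suc k | w
  ... | z | v = trans {j = inXbBelow m v k} refl (okBelow-unique m (inXbBelow m) (λ _ → refl) (λ _ _ → refl) v k)

inXb-okBelow : ∀ m {N} (w : Vec Bool N) → inXb m w ≡ okBelow m w N
inXb-okBelow m {zero} w = refl
inXb-okBelow m {suc k} w = trans (proj₂ (unfold m k w)) (cong (allowedAt m w k ∧_) (unfold-inXbBelow m k w))

bit : ∀ {N} → Vec Bool N → ℕ → Bool
bit {N} w k with k <? N
... | yes k<N = lookup w (fromℕ< k<N)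
... | no  _   = false

letter≡bit : ∀ {N} (w : Vec Bool N) k → letter w k ≡ val (bit w k)
letter≡bit {N} w k with k <? N
... | yes _ = refl
... | no  _ = refl

bit-< : ∀ {N} (w : Vec Bool N) {k} → bit w k ≡ true → k < N
bit-< {N} w {k} b with k <? N
... | yes k<N = k<N
... | no  _   = case b of λ ()

bit-fromℕ< : ∀ {N} (w : Vec Bool N) {k} (k<N : k < N) → bit w k ≡ lookup w (fromℕ< k<N)
bit-fromℕ< {N} w {k} k<N with k <? N
... | yes k<N′ = cong (λ p → lookup w (fromℕ< p)) (<-irrelevant k<N′ k<N)
... | no  k≮N  = ⊥-elim (k≮N k<N)

bit-toℕ : ∀ {N} (w : Vec Bool N) i → bit w (toℕ i) ≡ lookup w i
bit-toℕ w i = trans (bit-fromℕ< w (toℕ<n i)) (cong (lookup w) (fromℕ<-toℕ i (toℕ<n i)))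

flip : ∀ {N k} → k < N → Vec Bool N → Vec Bool N
flip k<N w = w [ fromℕ< k<N ]%= not

bit-flip : ∀ {N k} (k<N : k < N) (w : Vec Bool N) → bit (flip k<N w) k ≡ not (bit w k)
bit-flip k<N w = trans (bit-fromℕ< (flip k<N w) k<N)
  (trans (lookup∘updateAt (fromℕ< k<N) w) (cong not (sym (bit-fromℕ< w k<N))))

bit-flip-≢ : ∀ {N k j} (k<N : k < N) (w : Vec Bool N) → j ≢ k → bit (flip k<N w) j ≡ bit w j
bit-flip-≢ {N} {k} {j} k<N w j≢k with j <? N
... | yes j<N = lookup∘updateAt′ (fromℕ< j<N) (fromℕ< k<N)
  (λ eq → j≢k (trans (sym (toℕ-fromℕ< j<N)) (trans (cong toℕ eq) (toℕ-fromℕ< k<N)))) w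
... | no  _   = refl

Sparse : ℕ → ∀ {N} → Vec Bool N → Set
Sparse m w = ∀ {i j} → bit w i ≡ true → bit w j ≡ true → i < j → j ≤ i + m → ⊥

module _ {N} (w : Vec Bool N) where

  windowSum-one : ∀ {i} n s → bit w i ≡ true → s ≤ i → i < s + n → 1 ≤ windowSum w s n
  windowSum-one zero    s b s≤i i<s+n = ⊥-elim (1+n≰n (≤-trans i<s+n (≤-trans (≤-reflexive (+-identityʳ s)) s≤i)))
  windowSum-one (suc n) s b s≤i i<s+n with m≤n⇒m<n∨m≡n s≤i
  ... | inj₁ s<i  = ≤-trans (windowSum-one n (suc s) b s<i (≤-trans i<s+n (≤-reflexive (+-suc s n)))) (m≤n+m _ (letter w s))
  ... | inj₂ refl = ≤-trans (≤-reflexive (sym (trans (letter≡bit w s) (cong val b)))) (m≤m+n (letter w s) _)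

  windowSum-two : ∀ {i j} n s → bit w i ≡ true → bit w j ≡ true → s ≤ i → i < j → j < s + n → 2 ≤ windowSum w s n
  windowSum-two zero    s b b′ s≤i i<j j<s+n = ⊥-elim (1+n≰n (≤-trans j<s+n (≤-trans (≤-reflexive (+-identityʳ s)) (≤-trans s≤i (<⇒≤ i<j)))))
  windowSum-two (suc n) s b b′ s≤i i<j j<s+n with m≤n⇒m<n∨m≡n s≤i
  ... | inj₁ s<i  = ≤-trans (windowSum-two n (suc s) b b′ s<i i<j (≤-trans j<s+n (≤-reflexive (+-suc s n)))) (m≤n+m _ (letter w s))
  ... | inj₂ refl = +-mono-≤ (≤-reflexive (sym (trans (letter≡bit w s) (cong val b))))
                      (windowSum-one n (suc s) b′ i<j (≤-trans j<s+n (≤-reflexive (+-suc s n))))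

  windowSum-none : ∀ n s → (∀ i → s ≤ i → i < s + n → ¬ bit w i ≡ true) → windowSum w s n ≡ 0
  windowSum-none zero    s none = refl
  windowSum-none (suc n) s none = cong₂ _+_ first
    (windowSum-none n (suc s) (λ i s<i i< → none i (<⇒≤ s<i) (≤-trans i< (≤-reflexive (sym (+-suc s n))))))
    where
    first : letter w s ≡ 0
    first with bit w s in eq | letter≡bit w s
    ... | true  | _      = ⊥-elim (none s ≤-refl (m<m+n s (s≤s z≤n)) eq)
    ... | false | letter = letter

  windowSum-sparse : ∀ {m} → Sparse m w → ∀ n s → n ≤ suc m → windowSum w s n ≤ 1
  windowSum-sparse sparse zero    s _ = z≤n
  windowSum-sparse {m} sparse (suc n) s (s≤s n≤m) with bit w s in eq | letter≡bit w s
  ... | true  | letter = ≤-reflexive (cong₂ _+_ letter (windowSum-none n (suc s)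
          (λ { i s<i (s≤s i≤s+n) b → sparse eq b s<i (≤-trans i≤s+n (+-monoʳ-≤ s n≤m)) })))
  ... | false | letter = ≤-trans (≤-reflexive (cong (_+ windowSum w (suc s) n) letter))
          (windowSum-sparse sparse n (suc s) (≤-trans n≤m (n≤1+n m)))

  -- Two ones at distance at most `m` share a window: the one beginning at the left of them or, if
  -- that would pass the end of the word, the last window, which begins at `N ∸ suc m`.
  InX⇒Sparse : ∀ {m} → m < N → InX m w → Sparse m w
  InX⇒Sparse {m} m<N inX {i} {j} b b′ i<j j≤i+m with i + m <? N
  ... | yes i+m<N = 1+n≰n (≤-trans (windowSum-two (suc m) i b b′ ≤-refl i<j (≤-trans (s≤s j≤i+m) (≤-reflexive (sym (+-suc i m))))) (inX i i+m<N))
  ... | no  i+m≮N = 1+n≰n (≤-trans (windowSum-two (suc m) s b b′ s≤i i<j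
      (≤-trans (bit-< w b′) (≤-reflexive (sym (trans (+-suc s m) s+m))))) (inX s (≤-reflexive s+m)))
    where
    s : ℕ
    s = N ∸ suc m
    s+m : suc (s + m) ≡ N
    s+m = trans (sym (+-suc s m)) (m∸n+n≡m m<N)
    s≤i : s ≤ i
    s≤i = +-cancelʳ-≤ m s i (≤-trans (n≤1+n (s + m)) (≤-trans (≤-reflexive s+m) (≮⇒≥ i+m≮N)))

  Sparse⇒InX : ∀ {m} → Sparse m w → InX m w
  Sparse⇒InX {m} sparse i _ = windowSum-sparse sparse (suc m) i ≤-refl

  allowedAt-sound : ∀ m i → allowedAt m w i ≡ true → i + m < N → windowSum w i (suc m) ≤ 1
  allowedAt-sound m i allowed i+m<N = ≤ᵇ⇒≤ _ 1 (Equivalence.from T-≡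
    (trans (sym (cong (λ b → if b then windowSum w i (suc m) ≤ᵇ 1 else true) (Equivalence.to T-≡ (<⇒<ᵇ i+m<N)))) allowed))

  allowedAt-complete : ∀ m i → (i + m < N → windowSum w i (suc m) ≤ 1) → allowedAt m w i ≡ true
  allowedAt-complete m i ok = by ((i + m) <ᵇ N) refl
    where
    by : ∀ b → ((i + m) <ᵇ N) ≡ b → (if b then windowSum w i (suc m) ≤ᵇ 1 else true) ≡ true
    by true  eq = Equivalence.to T-≡ (≤⇒≤ᵇ (ok (<ᵇ⇒< (i + m) N (Equivalence.from T-≡ eq))))
    by false _  = refl

  okBelow-sound : ∀ m n → okBelow m w n ≡ true → ∀ i → i < n → i + m < N → windowSum w i (suc m) ≤ 1
  okBelow-sound m (suc n) ok i (s≤s i≤n) i+m<N with allowedAt m w n in eq | m≤n⇒m<n∨m≡n i≤n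
  ... | true | inj₁ i<n  = okBelow-sound m n ok i i<n i+m<N
  ... | true | inj₂ refl = allowedAt-sound m i eq i+m<N

  okBelow-complete : ∀ m n → InX m w → okBelow m w n ≡ true
  okBelow-complete m zero    inX = refl
  okBelow-complete m (suc n) inX = cong₂ _∧_ (allowedAt-complete m n (inX n)) (okBelow-complete m n inX)

  inXb⇒InX : ∀ m → inXb m w ≡ true → InX m w
  inXb⇒InX m ok i i+m<N = okBelow-sound m N (trans (sym (inXb-okBelow m w)) ok) i (≤-trans (s≤s (m≤m+n i m)) i+m<N) i+m<N

  InX⇒inXb : ∀ m → InX m w → inXb m w ≡ true
  InX⇒inXb m inX = trans (inXb-okBelow m w) (okBelow-complete m N inX)

toggle-accept : ∀ m {N k} (k<N : k < N) (w : Vec Bool N) → InX m (flip k<N w) → toggle m (fromℕ< k<N) w ≡ flip k<N w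
toggle-accept m k<N w inX rewrite InX⇒inXb (flip k<N w) m inX = refl

toggle-≢ : ∀ m {N k j} (k<N : k < N) (w : Vec Bool N) → j ≢ k → bit (toggle m (fromℕ< k<N) w) j ≡ bit w j
toggle-≢ m k<N w j≢k with inXb m (flip k<N w)
... | true  = bit-flip-≢ k<N w j≢k
... | false = refl

toggle-Sparse : ∀ {m N k} → m < N → (k<N : k < N) (w : Vec Bool N) → Sparse m w → Sparse m (toggle m (fromℕ< k<N) w)
toggle-Sparse {m} m<N k<N w sparse with inXb m (flip k<N w) in eq
... | true  = InX⇒Sparse (flip k<N w) m<N (inXb⇒InX (flip k<N w) m eq)
... | false = sparse

phiAux-suc : ∀ m {N k} (k<N : k < N) (w : Vec Bool N) → phiAux m (suc k) w ≡ toggle m (fromℕ< k<N) (phiAux m k w)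
phiAux-suc m {N} {k} k<N w with k <? N
... | yes k<N′ = cong (λ p → toggle m (fromℕ< p) (phiAux m k w)) (<-irrelevant k<N′ k<N)
... | no  k≮N  = ⊥-elim (k≮N k<N)

-- Just before column `k` is toggled, the word has its old letters from column `k` on and, by
-- `phi-settled`, its final letters before `k`.
phiAux-later : ∀ m {N} (w : Vec Bool N) k {j} → k ≤ N → k ≤ j → bit (phiAux m k w) j ≡ bit w j
phiAux-later m w zero    _   _   = refl
phiAux-later m w (suc k) k<N k<j = trans (cong (λ v → bit v _) (phiAux-suc m k<N w))
  (trans (toggle-≢ m k<N (phiAux m k w) (λ { refl → 1+n≰n k<j })) (phiAux-later m w k (<⇒≤ k<N) (<⇒≤ k<j)))

phiAux-settled : ∀ m {N} (w : Vec Bool N) {j} d k → j < k → d + k ≤ N → bit (phiAux m (d + k) w) j ≡ bit (phiAux m k w) j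
phiAux-settled m w zero    k j<k _ = refl
phiAux-settled m w (suc d) k j<k d+k<N = trans (cong (λ v → bit v _) (phiAux-suc m d+k<N w))
  (trans (toggle-≢ m d+k<N (phiAux m (d + k) w) (<⇒≢ (≤-trans j<k (m≤n+m k d)))) (phiAux-settled m w d k j<k (<⇒≤ d+k<N)))

phi-settled : ∀ m {N} (w : Vec Bool N) {j k} → j < k → k ≤ N → bit (phi m w) j ≡ bit (phiAux m k w) j
phi-settled m {N} w {j} {k} j<k k≤N = trans (cong (λ n → bit (phiAux m n w) j) (sym (m∸n+n≡m k≤N)))
  (phiAux-settled m w (N ∸ k) k j<k (≤-reflexive (m∸n+n≡m k≤N)))

phiAux-Sparse : ∀ {m N} → m < N → (w : Vec Bool N) → Sparse m w → ∀ k → k ≤ N → Sparse m (phiAux m k w)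
phiAux-Sparse m<N w sparse zero    _   = sparse
phiAux-Sparse {m} m<N w sparse (suc k) k<N =
  subst (λ v → Sparse m v) (sym (phiAux-suc m k<N w)) (toggle-Sparse m<N k<N (phiAux m k w) (phiAux-Sparse m<N w sparse k (<⇒≤ k<N)))

module _ {m N} (m<N : m < N) (w : Vec Bool N) (sparse : Sparse m w) where

  phi-Sparse : Sparse m (phi m w)
  phi-Sparse = phiAux-Sparse m<N w sparse N ≤-refl

  phi-at : ∀ {k} (k<N : k < N) → InX m (flip k<N (phiAux m k w)) → bit (phi m w) k ≡ not (bit w k)
  phi-at {k} k<N inX = begin
    bit (phi m w) k                                   ≡⟨ phi-settled m w ≤-refl k<N ⟩
    bit (phiAux m (suc k) w) k                        ≡⟨ cong (λ v → bit v k) (trans (phiAux-suc m k<N w) (toggle-accept m k<N (phiAux m k w) inX)) ⟩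
    bit (flip k<N (phiAux m k w)) k                   ≡⟨ bit-flip k<N (phiAux m k w) ⟩
    not (bit (phiAux m k w) k)                        ≡⟨ cong not (phiAux-later m w k (<⇒≤ k<N) ≤-refl) ⟩
    not (bit w k)                                     ∎

  -- For `i < j` the word just after toggling `i` contains both ones, contrary to sparsity. For
  -- `i = j` the old one is removed, since deleting a one is always allowed.
  phi-vert : ∀ {i j} → bit (phi m w) i ≡ true → bit w j ≡ true → i ≤ j → j ≤ i + m → ⊥
  phi-vert {i} {j} b b′ i≤j j≤i+m with m≤n⇒m<n∨m≡n i≤j
  ... | inj₁ i<j  = phiAux-Sparse m<N w sparse (suc i) i<N
                      (trans (sym (phi-settled m w ≤-refl i<N)) b) (trans (phiAux-later m w (suc i) i<N i<j) b′) i<j j≤i+m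
    where
    i<N : i < N
    i<N = bit-< (phi m w) b
  ... | inj₂ refl = case trans (sym b) (trans (phi-at i<N (Sparse⇒InX (flip i<N v) removed)) (cong not b′)) of λ ()
    where
    i<N : i < N
    i<N = bit-< w b′
    v : Vec Bool N
    v = phiAux m i w
    shrink : ∀ {j} → bit (flip i<N v) j ≡ true → bit v j ≡ true
    shrink {j} bj with j ≟ i
    ... | yes refl = trans (phiAux-later m w i (<⇒≤ i<N) ≤-refl) b′
    ... | no  j≢i  = trans (sym (bit-flip-≢ i<N v j≢i)) bj
    removed : Sparse m (flip i<N v)
    removed b₁ b₂ = phiAux-Sparse m<N w sparse i (<⇒≤ i<N) (shrink b₁) (shrink b₂)

  -- The word in which `i` is toggled has new letters before `i` and old ones after it, so the
  -- hypotheses say that a one fits at `i`; the first of them also says that there is none yet.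
  phi-fill : ∀ {i} → i < N → (∀ j → i ≤ j → j ≤ i + m → ¬ bit w j ≡ true) →
    (∀ j → j < i → i ≤ j + m → ¬ bit (phi m w) j ≡ true) → bit (phi m w) i ≡ true
  phi-fill {i} i<N old new = trans (phi-at i<N (Sparse⇒InX (flip i<N v) added)) (by (bit w i) refl)
    where
    by : ∀ b → bit w i ≡ b → not b ≡ true
    by true  eq = ⊥-elim (old i ≤-refl (m≤m+n i m) eq)
    by false _  = refl
    v : Vec Bool N
    v = phiAux m i w
    other : ∀ {j} → j ≢ i → bit (flip i<N v) j ≡ true → bit v j ≡ true
    other j≢i b = trans (sym (bit-flip-≢ i<N v j≢i)) b
    added : Sparse m (flip i<N v)
    added {j} {l} b b′ j<l l≤j+m with j ≟ i | l ≟ i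
    ... | yes refl | _        = old l (<⇒≤ j<l) l≤j+m (trans (sym (phiAux-later m w i (<⇒≤ i<N) (<⇒≤ j<l))) (other (≢-sym (<⇒≢ j<l)) b′))
    ... | no  j≢i  | yes refl = new j j<l l≤j+m (trans (phi-settled m w j<l (<⇒≤ i<N)) (other j≢i b))
    ... | no  j≢i  | no  l≢i  = phiAux-Sparse m<N w sparse i (<⇒≤ i<N) (other j≢i b) (other l≢i b′) j<l l≤j+m

-- Orbits as boards

board : ∀ m {N} → Vec Bool N → ℕ → ℕ → Bool
board m S t i = bit (iter (phi m) t S) i

board-isBoard : ∀ {m N′} → m ≤ N′ → (S : Vec Bool (suc N′)) → InX m S → IsBoard m N′ (board m S)
board-isBoard {m} m≤N′ S inX = record
  { range = λ {t} b → ≤-pred (bit-< (iter (phi m) t S) b)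
  ; indep = λ {t} → sparse t
  ; vert  = λ {t} → phi-vert (s≤s m≤N′) (iter (phi m) t S) (sparse t)
  ; fill  = λ {t} i≤N′ → phi-fill (s≤s m≤N′) (iter (phi m) t S) (sparse t) (s≤s i≤N′)
  }
  where
  sparse : ∀ t → Sparse m (iter (phi m) t S)
  sparse zero    = InX⇒Sparse S (s≤s m≤N′) inX
  sparse (suc t) = phi-Sparse (s≤s m≤N′) (iter (phi m) t S) (sparse t)

iter-periodic : ∀ {A : Set} (f : A → A) q {x} → iter f q x ≡ x → Periodic q (λ t → iter f t x)
iter-periodic f q {x} eq zero    = trans (cong (λ n → iter f n x) (+-identityʳ q)) eq
iter-periodic f q {x} eq (suc t) = trans (cong (λ n → iter f n x) (+-suc q t)) (cong f (iter-periodic f q eq t))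

-- The unconstrained case and the conclusion

phi-complement : ∀ {m} (w : Vec Bool m) {i} → i < m → bit (phi m w) i ≡ not (bit w i)
phi-complement {m} w {i} i<m = begin
  bit (phi m w) i                   ≡⟨ phi-settled m w ≤-refl i<m ⟩
  bit (phiAux m (suc i) w) i        ≡⟨ cong (λ v → bit v i) (trans (phiAux-suc m i<m w) (toggle-accept m i<m _ unconstrained)) ⟩
  bit (flip i<m (phiAux m i w)) i   ≡⟨ bit-flip i<m (phiAux m i w) ⟩
  not (bit (phiAux m i w) i)        ≡⟨ cong not (phiAux-later m w i (<⇒≤ i<m) ≤-refl) ⟩
  not (bit w i)                     ∎
  where
  unconstrained : ∀ {v : Vec Bool m} → InX m v
  unconstrained i i+m<m = ⊥-elim (1+n≰n (≤-trans (s≤s (m≤n+m m i)) i+m<m))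

-- Adding the sum to its shift by one pairs each letter with its complement.
alternating-sum : ∀ {q} (b : ℕ → Bool) → Periodic q b → (∀ t → b (suc t) ≡ not (b t)) →
  2 * sumTo q (λ t → val (b t)) ≡ q
alternating-sum {q} b periodic alternates = begin
  2 * X                                                          ≡⟨ cong (X +_) (+-identityʳ X) ⟩
  X + X                                                          ≡⟨ cong (X +_) (sumTo-shift (λ t → cong val (periodic t)) 1) ⟨
  X + sumTo q (λ t → val (b (suc t)))                            ≡⟨ sumTo-+ q _ _ ⟨
  sumTo q (λ t → val (b t) + val (b (suc t)))                    ≡⟨ sumTo-cong q (λ t → trans (cong (λ c → val (b t) + val c) (alternates t)) (val-not (b t))) ⟩
  sumTo q (λ _ → 1)                                              ≡⟨ sumTo-const q 1 ⟩
  q * 1                                                          ≡⟨ *-identityʳ q ⟩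
  q                                                              ∎
  where
  X : ℕ
  X = sumTo q (λ t → val (b t))
  val-not : ∀ c → val c + val (not c) ≡ 1
  val-not true  = refl
  val-not false = refl

theorem3 : (m N : ℕ) → 1 ≤ m → m ≤ N → (S : Vec Bool N) → InX m S →
    (q : ℕ) → 0 < q → iter (phi m) q S ≡ S →
    (∀ r → 0 < r → r < q → iter (phi m) r S ≢ S) →
    (i : Fin N) →
    sumTo q (λ t → val (lookup (iter (phi m) t S) i))
    ≡ sumTo q (λ t → val (lookup (iter (phi m) t S) (opposite i)))
theorem3 m@(suc _) N@(suc N′) _ m≤N S inX q _ φ^q _ i = begin
  sumTo q (λ t → val (lookup (iter (phi m) t S) i))             ≡⟨ letters i ⟩
  sumTo q (λ t → val (board m S t (toℕ i)))                     ≡⟨ symmetric (m≤n⇒m<n∨m≡n m≤N) ⟩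
  sumTo q (λ t → val (board m S t (toℕ (opposite i))))          ≡⟨ letters (opposite i) ⟨
  sumTo q (λ t → val (lookup (iter (phi m) t S) (opposite i)))  ∎
  where
  letters : ∀ i → sumTo q (λ t → val (lookup (iter (phi m) t S) i)) ≡ sumTo q (λ t → val (board m S t (toℕ i)))
  letters i = sumTo-cong q (λ t → cong val (sym (bit-toℕ (iter (phi m) t S) i)))
  periodic : ∀ i → Periodic q (λ t → board m S t i)
  periodic i t = cong (λ w → bit w i) (iter-periodic (phi m) q φ^q t)
  mirror : toℕ i + toℕ (opposite i) ≡ N′
  mirror = trans (cong (toℕ i +_) (opposite-prop i)) (m+[n∸m]≡n (≤-pred (toℕ<n i)))
  symmetric : m < N ⊎ m ≡ N → sumTo q (λ t → val (board m S t (toℕ i))) ≡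
    sumTo q (λ t → val (board m S t (toℕ (opposite i))))
  symmetric (inj₁ (s≤s m≤N′)) =
    Orbit.columns-symmetric (board-isBoard m≤N′ S inX) m≤N′ {q} periodic (toℕ i) (toℕ (opposite i)) mirror
  -- Every column has ones in half of the `q` rows, wherever it lies; doubling avoids the division.
  symmetric (inj₂ refl) = *-cancelˡ-≡ _ _ 2 (trans (half i) (sym (half (opposite i))))
    where
    half : ∀ i → 2 * sumTo q (λ t → val (board m S t (toℕ i))) ≡ q
    half i = alternating-sum {q} (λ t → board m S t (toℕ i)) (periodic (toℕ i)) (λ t → phi-complement (iter (phi m) t S) (toℕ<n i))
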